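{- The typable terms of each of the calculi $\lambda\mathbf{J}^{\mathbf{ms}}$, $\lambda\mathbf{J}^{\mathbf{m}}$ and $\lambda\mathbf{J}$ are strongly normalising (there is no infinite reduction sequence starting from a typable term).
   Context: Types $A::=X\mid A\supset B$; contexts $\Gamma$ are finite sets of declarations $x:A$ with distinct variables; substitution is capture-avoiding; all reduction relations are closed under all syntactic constructors. A value $V$ is a variable or a $\lambda$-abstraction. $\lambda\mathbf{J}$: terms $t,u,v::=x\mid\lambda x.t\mid t(u,x.v)$ ($x$ bound in $v$); generalised arguments $R,S$ are pairs $(u,x.v)$, and $tRS$ means $(tR)S$. Typing: $\Gamma,x:A\vdash x:A$; from $\Gamma,x:A\vdash t:B$ infer $\Gamma\vdash\lambda x.t:A\supset B$; from $\Gamma\vdash t:A\supset B$, $\Gamma\vdash u:A$, $\Gamma,x:B\vdash v:C$ infer $\Gamma\vdash t(u,x.v):C$. $(u,x.V)@S=(u,x.VS)$, $(u,x.tR')@S=(u,x.t(R'@S))$. Rules: $(\lambda x.t)(u,y.v)\rightarrow[[u/x]t/y]v$; $tRS\rightarrow t(R@S)$. $\lambda\mathbf{J}^{\mathbf m}$: terms $t::=x\mid\lambda x.t\mid t(u,l)$; co-terms $l::=u::l\mid(x)v$. Typing: $\Gamma,x:A\vdash x:A$; from $\Gamma\vdash t:A\supset B$, $\Gamma\vdash u:A$, $\Gamma\mid l:B\vdash C$ infer $\Gamma\vdash t(u,l):C$; from $\Gamma\vdash u:A$, $\Gamma\mid l:B\vdash C$ infer $\Gamma\mid u::l:A\supset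 B\vdash C$; $\lambda$-rule as usual; from $\Gamma,x:A\vdash v:B$ infer $\Gamma\mid(x)v:A\vdash B$. With generalised arguments $R,S$ of the form $(u,l)$: $(u::l)@S=u::(l@S)$, $((x)V)@S=(x)(VS)$, $((x)t(u,l))@S=(x)t(u,l@S)$, $(u,l)@S=(u,l@S)$. Rules: $(\lambda x.t)(u,(y)v)\rightarrow[[u/x]t/y]v$; $(\lambda x.t)(u,v::l)\rightarrow([u/x]t)(v,l)$; $tRS\rightarrow t(R@S)$; $(x)x(u,l)\rightarrow u::l$ if $x\notin u,l$. $\lambda\mathbf{J}^{\mathbf{ms}}$: terms $t::=x\mid\lambda x.t\mid t\,l$; co-terms $l::=u::l\mid(x)v$. Typing: axiom and $\lambda$-rule as usual; from $\Gamma\vdash t:A$, $\Gamma\mid l:A\vdash B$ infer $\Gamma\vdash t\,l:B$; rules for $u::l$ and $(x)v$ as in $\lambda\mathbf{J}^{\mathbf m}$. $(u::l)@l'=u::(l@l')$, $((x)V)@l'=(x)(V\,l')$, $((x)t\,l)@l'=(x)t\,(l@l')$. Rules: $(\lambda x.t)(u::l)\rightarrow u((x)t\,l)$; $t(x)v\rightarrow[t/x]v$; $(t\,l)(u::l')\rightarrow t\,(l@(u::l'))$; $(x)x\,l\rightarrow l$ if $x\notin l$. A term is typable if $\Gamma\vdash t:A$ for some $\Gamma,A$. -}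

module Defs where

-- Terms are well-scoped de Bruijn terms: a term of type Tm n has free
-- variables among Fin n; binders shift indices.

open import Data.Nat using (ℕ; zero; suc)
open import Data.Fin using (Fin; zero; suc)
open import Data.Vec using (Vec; lookup; _∷_)
open import Data.Product using (Σ; _×_; _,_; ∃)
open import Relation.Nullary using (¬_)
open import Relation.Binary.PropositionalEquality using (_≡_)

infixr 7 _⊃_
data Ty : Set where
  atom : ℕ → Ty
  _⊃_  : Ty → Ty → Ty

SN : {A : Set} → (A → A → Set) → A → Set
SN {A} _⟶_ a = ¬ (Σ (ℕ → A) λ f → f 0 ≡ a × (∀ i → f i ⟶ f (suc i)))

ext : {n m : ℕ} → (Fin n → Fin m) → Fin (suc n) → Fin (suc m)
ext ρ zero    = zero
ext ρ (suc i) = suc (ρ i)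

module J where
  data Tm (n : ℕ) : Set where
    var : Fin n → Tm n
    lam : Tm (suc n) → Tm n
    app : Tm n → Tm n → Tm (suc n) → Tm n

  ren : {n m : ℕ} → (Fin n → Fin m) → Tm n → Tm m
  ren ρ (var i)     = var (ρ i)
  ren ρ (lam t)     = lam (ren (ext ρ) t)
  ren ρ (app t u v) = app (ren ρ t) (ren ρ u) (ren (ext ρ) v)

  exts : {n m : ℕ} → (Fin n → Tm m) → Fin (suc n) → Tm (suc m)
  exts σ zero    = var zero
  exts σ (suc i) = ren suc (σ i)

  sub : {n m : ℕ} → (Fin n → Tm m) → Tm n → Tm m
  sub σ (var i)     = σ i
  sub σ (lam t)     = lam (sub (exts σ) t)
  sub σ (app t u v) = app (sub σ t) (sub σ u) (sub (exts σ) v)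

  sub1 : {n : ℕ} → Tm n → Fin (suc n) → Tm n
  sub1 u zero    = u
  sub1 u (suc i) = var i

  _[_] : {n : ℕ} → Tm (suc n) → Tm n → Tm n
  t [ u ] = sub (sub1 u) t

  wk : {n : ℕ} → Tm n → Tm (suc n)
  wk = ren suc

  wk1 : {n : ℕ} → Tm (suc n) → Tm (suc (suc n))
  wk1 = ren (ext suc)

  -- cat v u' v'  is the body of  (u, x.v) @ (u', y.v')  i.e.  (u, x.cat v ...),
  -- where u', y.v' have already been moved under the binder x.
  --   (u,x.V)@S = (u,x.VS) ;  (u,x.tR')@S = (u,x.t(R'@S))
  cat : {n : ℕ} → Tm n → Tm n → Tm (suc n) → Tm n
  cat (var i)     u' v' = app (var i) u' v'
  cat (lam t)     u' v' = app (lam t) u' v'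
  cat (app t u v) u' v' = app t u (cat v (wk u') (wk1 v'))

  infix 4 _⟶_
  data _⟶_ {n : ℕ} : Tm n → Tm n → Set where
    β    : {t : Tm (suc n)} {u : Tm n} {v : Tm (suc n)} →
           app (lam t) u v ⟶ v [ t [ u ] ]
    π    : {t u u' : Tm n} {v : Tm (suc n)} {v' : Tm (suc n)} →
           app (app t u v) u' v' ⟶ app t u (cat v (wk u') (wk1 v'))
    ξlam : {t t' : Tm (suc n)} → t ⟶ t' → lam t ⟶ lam t'
    ξ₁   : {t t' u : Tm n} {v : Tm (suc n)} → t ⟶ t' → app t u v ⟶ app t' u v
    ξ₂   : {t u u' : Tm n} {v : Tm (suc n)} → u ⟶ u' → app t u v ⟶ app t u' v
    ξ₃   : {t u : Tm n} {v v' : Tm (suc n)} → v ⟶ v' → app t u v ⟶ app t u v'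

  infix 3 _⊢_∶_
  data _⊢_∶_ {n : ℕ} (Γ : Vec Ty n) : Tm n → Ty → Set where
    ax  : (i : Fin n) → Γ ⊢ var i ∶ lookup Γ i
    ⊃I  : {A B : Ty} {t : Tm (suc n)} → A ∷ Γ ⊢ t ∶ B → Γ ⊢ lam t ∶ A ⊃ B
    ⊃E  : {A B C : Ty} {t u : Tm n} {v : Tm (suc n)} →
          Γ ⊢ t ∶ A ⊃ B → Γ ⊢ u ∶ A → B ∷ Γ ⊢ v ∶ C → Γ ⊢ app t u v ∶ C

  Typable : {n : ℕ} → Tm n → Set
  Typable {n} t = Σ (Vec Ty n) λ Γ → ∃ λ A → Γ ⊢ t ∶ A

module Jm where
  mutual
    data Tm (n : ℕ) : Set where
      var : Fin n → Tm n
      lam : Tm (suc n) → Tm n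
      app : Tm n → Tm n → CoTm n → Tm n

    data CoTm (n : ℕ) : Set where
      cons : Tm n → CoTm n → CoTm n
      abs  : Tm (suc n) → CoTm n

  mutual
    ren : {n m : ℕ} → (Fin n → Fin m) → Tm n → Tm m
    ren ρ (var i)     = var (ρ i)
    ren ρ (lam t)     = lam (ren (ext ρ) t)
    ren ρ (app t u l) = app (ren ρ t) (ren ρ u) (renL ρ l)

    renL : {n m : ℕ} → (Fin n → Fin m) → CoTm n → CoTm m
    renL ρ (cons u l) = cons (ren ρ u) (renL ρ l)
    renL ρ (abs v)    = abs (ren (ext ρ) v)

  exts : {n m : ℕ} → (Fin n → Tm m) → Fin (suc n) → Tm (suc m)
  exts σ zero    = var zero
  exts σ (suc i) = ren suc (σ i)

  mutual
    sub : {n m : ℕ} → (Fin n → Tm m) → Tm n → Tm m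
    sub σ (var i)     = σ i
    sub σ (lam t)     = lam (sub (exts σ) t)
    sub σ (app t u l) = app (sub σ t) (sub σ u) (subL σ l)

    subL : {n m : ℕ} → (Fin n → Tm m) → CoTm n → CoTm m
    subL σ (cons u l) = cons (sub σ u) (subL σ l)
    subL σ (abs v)    = abs (sub (exts σ) v)

  sub1 : {n : ℕ} → Tm n → Fin (suc n) → Tm n
  sub1 u zero    = u
  sub1 u (suc i) = var i

  _[_] : {n : ℕ} → Tm (suc n) → Tm n → Tm n
  t [ u ] = sub (sub1 u) t

  wk : {n : ℕ} → Tm n → Tm (suc n)
  wk = ren suc

  wkL : {n : ℕ} → CoTm n → CoTm (suc n)
  wkL = renL suc

  catL : {n : ℕ} → CoTm n → Tm n → CoTm n → CoTm n
  catL (cons u l)          u' l' = cons u (catL l u' l')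
  catL (abs (var i))       u' l' = abs (app (var i) (wk u') (wkL l'))
  catL (abs (lam t))       u' l' = abs (app (lam t) (wk u') (wkL l'))
  catL (abs (app t u l))   u' l' = abs (app t u (catL l (wk u') (wkL l')))

  infix 4 _⟶_ _⟶ₗ_
  mutual
    data _⟶_ {n : ℕ} : Tm n → Tm n → Set where
      β₁   : {t : Tm (suc n)} {u : Tm n} {v : Tm (suc n)} →
             app (lam t) u (abs v) ⟶ v [ t [ u ] ]
      β₂   : {t : Tm (suc n)} {u v : Tm n} {l : CoTm n} →
             app (lam t) u (cons v l) ⟶ app (t [ u ]) v l
      π    : {t u u' : Tm n} {l l' : CoTm n} →
             app (app t u l) u' l' ⟶ app t u (catL l u' l')
      ξlam : {t t' : Tm (suc n)} → t ⟶ t' → lam t ⟶ lam t'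
      ξ₁   : {t t' u : Tm n} {l : CoTm n} → t ⟶ t' → app t u l ⟶ app t' u l
      ξ₂   : {t u u' : Tm n} {l : CoTm n} → u ⟶ u' → app t u l ⟶ app t u' l
      ξ₃   : {t u : Tm n} {l l' : CoTm n} → l ⟶ₗ l' → app t u l ⟶ app t u l'

    data _⟶ₗ_ {n : ℕ} : CoTm n → CoTm n → Set where
      -- (x)x(u,l) → u::l  if x ∉ u,l  (u,l are weakenings of terms not mentioning x)
      η     : {u : Tm n} {l : CoTm n} →
              abs (app (var zero) (wk u) (wkL l)) ⟶ₗ cons u l
      ξcons₁ : {u u' : Tm n} {l : CoTm n} → u ⟶ u' → cons u l ⟶ₗ cons u' l
      ξcons₂ : {u : Tm n} {l l' : CoTm n} → l ⟶ₗ l' → cons u l ⟶ₗ cons u l'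
      ξabs  : {v v' : Tm (suc n)} → v ⟶ v' → abs v ⟶ₗ abs v'

  infix 3 _⊢_∶_ _∣_∶_⊢_
  mutual
    data _⊢_∶_ {n : ℕ} (Γ : Vec Ty n) : Tm n → Ty → Set where
      ax  : (i : Fin n) → Γ ⊢ var i ∶ lookup Γ i
      ⊃I  : {A B : Ty} {t : Tm (suc n)} → A ∷ Γ ⊢ t ∶ B → Γ ⊢ lam t ∶ A ⊃ B
      ⊃E  : {A B C : Ty} {t u : Tm n} {l : CoTm n} →
            Γ ⊢ t ∶ A ⊃ B → Γ ⊢ u ∶ A → Γ ∣ l ∶ B ⊢ C → Γ ⊢ app t u l ∶ C

    data _∣_∶_⊢_ {n : ℕ} (Γ : Vec Ty n) : CoTm n → Ty → Ty → Set where
      ⊃L  : {A B C : Ty} {u : Tm n} {l : CoTm n} →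
            Γ ⊢ u ∶ A → Γ ∣ l ∶ B ⊢ C → Γ ∣ cons u l ∶ A ⊃ B ⊢ C
      sel : {A B : Ty} {v : Tm (suc n)} → A ∷ Γ ⊢ v ∶ B → Γ ∣ abs v ∶ A ⊢ B

  Typable : {n : ℕ} → Tm n → Set
  Typable {n} t = Σ (Vec Ty n) λ Γ → ∃ λ A → Γ ⊢ t ∶ A

module Jms where
  mutual
    data Tm (n : ℕ) : Set where
      var : Fin n → Tm n
      lam : Tm (suc n) → Tm n
      app : Tm n → CoTm n → Tm n

    data CoTm (n : ℕ) : Set where
      cons : Tm n → CoTm n → CoTm n
      abs  : Tm (suc n) → CoTm n

  mutual
    ren : {n m : ℕ} → (Fin n → Fin m) → Tm n → Tm m
    ren ρ (var i)   = var (ρ i)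
    ren ρ (lam t)   = lam (ren (ext ρ) t)
    ren ρ (app t l) = app (ren ρ t) (renL ρ l)

    renL : {n m : ℕ} → (Fin n → Fin m) → CoTm n → CoTm m
    renL ρ (cons u l) = cons (ren ρ u) (renL ρ l)
    renL ρ (abs v)    = abs (ren (ext ρ) v)

  exts : {n m : ℕ} → (Fin n → Tm m) → Fin (suc n) → Tm (suc m)
  exts σ zero    = var zero
  exts σ (suc i) = ren suc (σ i)

  mutual
    sub : {n m : ℕ} → (Fin n → Tm m) → Tm n → Tm m
    sub σ (var i)   = σ i
    sub σ (lam t)   = lam (sub (exts σ) t)
    sub σ (app t l) = app (sub σ t) (subL σ l)

    subL : {n m : ℕ} → (Fin n → Tm m) → CoTm n → CoTm m
    subL σ (cons u l) = cons (sub σ u) (subL σ l)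
    subL σ (abs v)    = abs (sub (exts σ) v)

  sub1 : {n : ℕ} → Tm n → Fin (suc n) → Tm n
  sub1 u zero    = u
  sub1 u (suc i) = var i

  _[_] : {n : ℕ} → Tm (suc n) → Tm n → Tm n
  t [ u ] = sub (sub1 u) t

  wkL : {n : ℕ} → CoTm n → CoTm (suc n)
  wkL = renL suc

  catL : {n : ℕ} → CoTm n → CoTm n → CoTm n
  catL (cons u l)        l' = cons u (catL l l')
  catL (abs (var i))     l' = abs (app (var i) (wkL l'))
  catL (abs (lam t))     l' = abs (app (lam t) (wkL l'))
  catL (abs (app t l))   l' = abs (app t (catL l (wkL l')))

  infix 4 _⟶_ _⟶ₗ_
  mutual
    data _⟶_ {n : ℕ} : Tm n → Tm n → Set where
      β    : {t : Tm (suc n)} {u : Tm n} {l : CoTm n} →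
             app (lam t) (cons u l) ⟶ app u (abs (app t (wkL l)))
      σ    : {t : Tm n} {v : Tm (suc n)} → app t (abs v) ⟶ v [ t ]
      π    : {t u : Tm n} {l l' : CoTm n} →
             app (app t l) (cons u l') ⟶ app t (catL l (cons u l'))
      ξlam : {t t' : Tm (suc n)} → t ⟶ t' → lam t ⟶ lam t'
      ξ₁   : {t t' : Tm n} {l : CoTm n} → t ⟶ t' → app t l ⟶ app t' l
      ξ₂   : {t : Tm n} {l l' : CoTm n} → l ⟶ₗ l' → app t l ⟶ app t l'

    data _⟶ₗ_ {n : ℕ} : CoTm n → CoTm n → Set where
      -- (x)x l → l  if x ∉ l
      η      : {l : CoTm n} → abs (app (var zero) (wkL l)) ⟶ₗ l
      ξcons₁ : {u u' : Tm n} {l : CoTm n} → u ⟶ u' → cons u l ⟶ₗ cons u' l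
      ξcons₂ : {u : Tm n} {l l' : CoTm n} → l ⟶ₗ l' → cons u l ⟶ₗ cons u l'
      ξabs   : {v v' : Tm (suc n)} → v ⟶ v' → abs v ⟶ₗ abs v'

  infix 3 _⊢_∶_ _∣_∶_⊢_
  mutual
    data _⊢_∶_ {n : ℕ} (Γ : Vec Ty n) : Tm n → Ty → Set where
      ax  : (i : Fin n) → Γ ⊢ var i ∶ lookup Γ i
      ⊃I  : {A B : Ty} {t : Tm (suc n)} → A ∷ Γ ⊢ t ∶ B → Γ ⊢ lam t ∶ A ⊃ B
      cut : {A B : Ty} {t : Tm n} {l : CoTm n} →
            Γ ⊢ t ∶ A → Γ ∣ l ∶ A ⊢ B → Γ ⊢ app t l ∶ B

    data _∣_∶_⊢_ {n : ℕ} (Γ : Vec Ty n) : CoTm n → Ty → Ty → Set where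
      ⊃L  : {A B C : Ty} {u : Tm n} {l : CoTm n} →
            Γ ⊢ u ∶ A → Γ ∣ l ∶ B ⊢ C → Γ ∣ cons u l ∶ A ⊃ B ⊢ C
      sel : {A B : Ty} {v : Tm (suc n)} → A ∷ Γ ⊢ v ∶ B → Γ ∣ abs v ∶ A ⊢ B

  Typable : {n : ℕ} → Tm n → Set
  Typable {n} t = Σ (Vec Ty n) λ Γ → ∃ λ A → Γ ⊢ t ∶ A

-- The translations λJ → λJ^m → λJ^ms map every reduction step to at least
-- one step, so it suffices to normalise typable λJ^ms-terms, which we do with
-- reducibility candidates defined by orthogonality between terms and
-- co-terms.  The delicate rule is the permutation π: substitution does not
-- commute with it on the nose, and other steps can create π-redexes.  Both are
-- handled by a parallel π-contraction relation Par, whose backward simulation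
-- (measured by the number of contracted spines) shows that sn is closed under
-- π-expansion and under a step inside a substituted term.
module Submission where

open import Defs
open import Data.Nat using (ℕ; zero; suc; _+_; _<_; s≤s)
open import Data.Nat.Properties using (+-assoc; ≤-reflexive; +-monoˡ-<; +-monoʳ-<)
open import Data.Nat.Induction using (<-wellFounded)
open import Data.Fin using (Fin; zero; suc)
open import Data.Vec using (Vec; lookup; _∷_)
open import Data.Product using (∃; _×_; _,_; proj₁; proj₂)
open import Data.Sum using (_⊎_; inj₁; inj₂)
open import Function using (_∘_; id; flip)
open import Induction.WellFounded using (Acc; acc; acc-inverse)
open import Relation.Binary.PropositionalEquality hiding ([_])
open import Relation.Binary.Construct.Closure.ReflexiveTransitive using (Star; ε; _◅_; _◅◅_; gmap)

infix 4 _⁺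

_⁺ : {A : Set} → (A → A → Set) → A → A → Set
(R ⁺) x z = ∃ λ y → R x y × Star R y z

sn : {A : Set} → (A → A → Set) → A → Set
sn R = Acc (flip R)

module _ {A : Set} {R : A → A → Set} where

  ⁺⇒⋆ : ∀ {x y} → (R ⁺) x y → Star R x y
  ⁺⇒⋆ (_ , r , rs) = r ◅ rs

  _⁺◅◅_ : ∀ {x y z} → (R ⁺) x y → Star R y z → (R ⁺) x z
  (_ , r , rs) ⁺◅◅ rs′ = _ , r , rs ◅◅ rs′

  sn⇒SN : ∀ {a} → sn R a → SN R a
  sn⇒SN (acc h) (f , refl , steps) = sn⇒SN (h (steps 0)) (f ∘ suc , refl , steps ∘ suc)

  sn-⋆ : ∀ {a b} → sn R a → Star R a b → sn R b
  sn-⋆ h ε = h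
  sn-⋆ (acc h) (r ◅ rs) = sn-⋆ (h r) rs

gmap⁺ : {A B : Set} {R : A → A → Set} {S : B → B → Set} (f : A → B) →
        (∀ {x y} → R x y → S (f x) (f y)) → ∀ {x y} → (R ⁺) x y → (S ⁺) (f x) (f y)
gmap⁺ f g (_ , r , rs) = _ , g r , gmap f g rs

module _ {A B : Set} {R : A → A → Set} {S : B → B → Set}
         (f : A → B) (simulate : ∀ {a a′} → R a a′ → (S ⁺) (f a) (f a′)) where

  sn-reflect : ∀ {a} → sn S (f a) → sn R a
  sn-reflect h = reach h ε
    where
    mutual
      reach : ∀ {b a} → sn S b → Star S b (f a) → sn R a
      reach (acc h) (s ◅ ss) = reach (h s) ss
      reach h ε = acc λ r → reach⁺ h (simulate r)

      reach⁺ : ∀ {b a} → sn S b → (S ⁺) b (f a) → sn R a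
      reach⁺ (acc h) (_ , s , ss) = reach (h s) ss

sn-reflect₁ : {A B : Set} {R : A → A → Set} {S : B → B → Set} (f : A → B) →
              (∀ {a a′} → R a a′ → S (f a) (f a′)) → ∀ {a} → sn S (f a) → sn R a
sn-reflect₁ f simulate = sn-reflect f λ r → _ , simulate r , ε

module Ms where

  open Jms

  ext-cong : ∀ {n m} {ρ ρ′ : Fin n → Fin m} → (∀ i → ρ i ≡ ρ′ i) → ∀ i → ext ρ i ≡ ext ρ′ i
  ext-cong h zero    = refl
  ext-cong h (suc i) = cong suc (h i)

  mutual
    ren-cong : ∀ {n m} {ρ ρ′ : Fin n → Fin m} → (∀ i → ρ i ≡ ρ′ i) → ∀ t → ren ρ t ≡ ren ρ′ t
    ren-cong h (var i)   = cong var (h i)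
    ren-cong h (lam t)   = cong lam (ren-cong (ext-cong h) t)
    ren-cong h (app t l) = cong₂ app (ren-cong h t) (renL-cong h l)

    renL-cong : ∀ {n m} {ρ ρ′ : Fin n → Fin m} → (∀ i → ρ i ≡ ρ′ i) → ∀ l → renL ρ l ≡ renL ρ′ l
    renL-cong h (cons u l) = cong₂ cons (ren-cong h u) (renL-cong h l)
    renL-cong h (abs v)    = cong abs (ren-cong (ext-cong h) v)

  ext-∘ : ∀ {n m k} (ρ : Fin m → Fin k) (ρ′ : Fin n → Fin m) i → ext ρ (ext ρ′ i) ≡ ext (ρ ∘ ρ′) i
  ext-∘ ρ ρ′ zero    = refl
  ext-∘ ρ ρ′ (suc i) = refl

  mutual
    ren-∘ : ∀ {n m k} (ρ : Fin m → Fin k) (ρ′ : Fin n → Fin m) t → ren ρ (ren ρ′ t) ≡ ren (ρ ∘ ρ′) t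
    ren-∘ ρ ρ′ (var i)   = refl
    ren-∘ ρ ρ′ (lam t)   = cong lam (trans (ren-∘ (ext ρ) (ext ρ′) t) (ren-cong (ext-∘ ρ ρ′) t))
    ren-∘ ρ ρ′ (app t l) = cong₂ app (ren-∘ ρ ρ′ t) (renL-∘ ρ ρ′ l)

    renL-∘ : ∀ {n m k} (ρ : Fin m → Fin k) (ρ′ : Fin n → Fin m) l → renL ρ (renL ρ′ l) ≡ renL (ρ ∘ ρ′) l
    renL-∘ ρ ρ′ (cons u l) = cong₂ cons (ren-∘ ρ ρ′ u) (renL-∘ ρ ρ′ l)
    renL-∘ ρ ρ′ (abs v)    = cong abs (trans (ren-∘ (ext ρ) (ext ρ′) v) (ren-cong (ext-∘ ρ ρ′) v))

  ext-id : ∀ {n} (i : Fin (suc n)) → ext id i ≡ i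
  ext-id zero    = refl
  ext-id (suc i) = refl

  mutual
    ren-id : ∀ {n} (t : Tm n) → ren id t ≡ t
    ren-id (var i)   = refl
    ren-id (lam t)   = cong lam (trans (ren-cong ext-id t) (ren-id t))
    ren-id (app t l) = cong₂ app (ren-id t) (renL-id l)

    renL-id : ∀ {n} (l : CoTm n) → renL id l ≡ l
    renL-id (cons u l) = cong₂ cons (ren-id u) (renL-id l)
    renL-id (abs v)    = cong abs (trans (ren-cong ext-id v) (ren-id v))

  ren-ext-wk : ∀ {n m} (ρ : Fin n → Fin m) t → ren (ext ρ) (ren suc t) ≡ ren suc (ren ρ t)
  ren-ext-wk ρ t = trans (ren-∘ (ext ρ) suc t) (sym (ren-∘ suc ρ t))

  renL-ext-wk : ∀ {n m} (ρ : Fin n → Fin m) l → renL (ext ρ) (wkL l) ≡ wkL (renL ρ l)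
  renL-ext-wk ρ l = trans (renL-∘ (ext ρ) suc l) (sym (renL-∘ suc ρ l))

  exts-cong : ∀ {n m} {θ θ′ : Fin n → Tm m} → (∀ i → θ i ≡ θ′ i) → ∀ i → exts θ i ≡ exts θ′ i
  exts-cong h zero    = refl
  exts-cong h (suc i) = cong (ren suc) (h i)

  mutual
    sub-cong : ∀ {n m} {θ θ′ : Fin n → Tm m} → (∀ i → θ i ≡ θ′ i) → ∀ t → sub θ t ≡ sub θ′ t
    sub-cong h (var i)   = h i
    sub-cong h (lam t)   = cong lam (sub-cong (exts-cong h) t)
    sub-cong h (app t l) = cong₂ app (sub-cong h t) (subL-cong h l)

    subL-cong : ∀ {n m} {θ θ′ : Fin n → Tm m} → (∀ i → θ i ≡ θ′ i) → ∀ l → subL θ l ≡ subL θ′ l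
    subL-cong h (cons u l) = cong₂ cons (sub-cong h u) (subL-cong h l)
    subL-cong h (abs v)    = cong abs (sub-cong (exts-cong h) v)

  ren-exts : ∀ {n m k} (ρ : Fin m → Fin k) (θ : Fin n → Tm m) i → ren (ext ρ) (exts θ i) ≡ exts (ren ρ ∘ θ) i
  ren-exts ρ θ zero    = refl
  ren-exts ρ θ (suc i) = ren-ext-wk ρ (θ i)

  mutual
    ren-sub : ∀ {n m k} (ρ : Fin m → Fin k) (θ : Fin n → Tm m) t → ren ρ (sub θ t) ≡ sub (ren ρ ∘ θ) t
    ren-sub ρ θ (var i)   = refl
    ren-sub ρ θ (lam t)   = cong lam (ren-exts-sub ρ θ t)
    ren-sub ρ θ (app t l) = cong₂ app (ren-sub ρ θ t) (renL-sub ρ θ l)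

    renL-sub : ∀ {n m k} (ρ : Fin m → Fin k) (θ : Fin n → Tm m) l → renL ρ (subL θ l) ≡ subL (ren ρ ∘ θ) l
    renL-sub ρ θ (cons u l) = cong₂ cons (ren-sub ρ θ u) (renL-sub ρ θ l)
    renL-sub ρ θ (abs v)    = cong abs (ren-exts-sub ρ θ v)

    ren-exts-sub : ∀ {n m k} (ρ : Fin m → Fin k) (θ : Fin n → Tm m) t →
                   ren (ext ρ) (sub (exts θ) t) ≡ sub (exts (ren ρ ∘ θ)) t
    ren-exts-sub ρ θ t = trans (ren-sub (ext ρ) (exts θ) t) (sub-cong (ren-exts ρ θ) t)

  exts-ext : ∀ {n m k} (θ : Fin m → Tm k) (ρ : Fin n → Fin m) i → exts θ (ext ρ i) ≡ exts (θ ∘ ρ) i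
  exts-ext θ ρ zero    = refl
  exts-ext θ ρ (suc i) = refl

  mutual
    sub-ren : ∀ {n m k} (θ : Fin m → Tm k) (ρ : Fin n → Fin m) t → sub θ (ren ρ t) ≡ sub (θ ∘ ρ) t
    sub-ren θ ρ (var i)   = refl
    sub-ren θ ρ (lam t)   = cong lam (trans (sub-ren (exts θ) (ext ρ) t) (sub-cong (exts-ext θ ρ) t))
    sub-ren θ ρ (app t l) = cong₂ app (sub-ren θ ρ t) (subL-ren θ ρ l)

    subL-ren : ∀ {n m k} (θ : Fin m → Tm k) (ρ : Fin n → Fin m) l → subL θ (renL ρ l) ≡ subL (θ ∘ ρ) l
    subL-ren θ ρ (cons u l) = cong₂ cons (sub-ren θ ρ u) (subL-ren θ ρ l)
    subL-ren θ ρ (abs v)    = cong abs (trans (sub-ren (exts θ) (ext ρ) v) (sub-cong (exts-ext θ ρ) v))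

  exts-exts : ∀ {n m k} (θ : Fin m → Tm k) (θ′ : Fin n → Tm m) i → sub (exts θ) (exts θ′ i) ≡ exts (sub θ ∘ θ′) i
  exts-exts θ θ′ zero    = refl
  exts-exts θ θ′ (suc i) = trans (sub-ren (exts θ) suc (θ′ i)) (sym (ren-sub suc θ (θ′ i)))

  mutual
    sub-sub : ∀ {n m k} (θ : Fin m → Tm k) (θ′ : Fin n → Tm m) t → sub θ (sub θ′ t) ≡ sub (sub θ ∘ θ′) t
    sub-sub θ θ′ (var i)   = refl
    sub-sub θ θ′ (lam t)   = cong lam (trans (sub-sub (exts θ) (exts θ′) t) (sub-cong (exts-exts θ θ′) t))
    sub-sub θ θ′ (app t l) = cong₂ app (sub-sub θ θ′ t) (subL-sub θ θ′ l)

    subL-sub : ∀ {n m k} (θ : Fin m → Tm k) (θ′ : Fin n → Tm m) l → subL θ (subL θ′ l) ≡ subL (sub θ ∘ θ′) l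
    subL-sub θ θ′ (cons u l) = cong₂ cons (sub-sub θ θ′ u) (subL-sub θ θ′ l)
    subL-sub θ θ′ (abs v)    = cong abs (trans (sub-sub (exts θ) (exts θ′) v) (sub-cong (exts-exts θ θ′) v))

  exts-var : ∀ {n} (i : Fin (suc n)) → exts var i ≡ var i
  exts-var zero    = refl
  exts-var (suc i) = refl

  mutual
    sub-var : ∀ {n} (t : Tm n) → sub var t ≡ t
    sub-var (var i)   = refl
    sub-var (lam t)   = cong lam (trans (sub-cong exts-var t) (sub-var t))
    sub-var (app t l) = cong₂ app (sub-var t) (subL-var l)

    subL-var : ∀ {n} (l : CoTm n) → subL var l ≡ l
    subL-var (cons u l) = cong₂ cons (sub-var u) (subL-var l)
    subL-var (abs v)    = cong abs (trans (sub-cong exts-var v) (sub-var v))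

  sub-ren-cancel : ∀ {n m} {θ : Fin m → Tm n} {ρ : Fin n → Fin m} → (∀ i → θ (ρ i) ≡ var i) → ∀ t →
                   sub θ (ren ρ t) ≡ t
  sub-ren-cancel {θ = θ} {ρ} h t = trans (sub-ren θ ρ t) (trans (sub-cong h t) (sub-var t))

  infixr 5 _∷ₛ_
  _∷ₛ_ : ∀ {n m} → Tm m → (Fin n → Tm m) → Fin (suc n) → Tm m
  (t ∷ₛ θ) zero    = t
  (t ∷ₛ θ) (suc i) = θ i

  []-wk : ∀ {n} (s : Tm n) t → (ren suc t) [ s ] ≡ t
  []-wk s = sub-ren-cancel λ i → refl

  []-wkL : ∀ {n} (s : Tm n) l → subL (sub1 s) (wkL l) ≡ l
  []-wkL s l = trans (subL-ren (sub1 s) suc l) (subL-var l)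

  []-exts : ∀ {n m} (s : Tm m) (θ : Fin n → Tm m) t → (sub (exts θ) t) [ s ] ≡ sub (s ∷ₛ θ) t
  []-exts s θ t = trans (sub-sub (sub1 s) (exts θ) t) (sub-cong pointwise t)
    where
    pointwise : ∀ i → sub (sub1 s) (exts θ i) ≡ (s ∷ₛ θ) i
    pointwise zero    = refl
    pointwise (suc i) = []-wk s (θ i)

  subL-exts-wk : ∀ {n m} (θ : Fin n → Tm m) l → subL (exts θ) (wkL l) ≡ wkL (subL θ l)
  subL-exts-wk θ l = trans (subL-ren (exts θ) suc l) (sym (renL-sub suc θ l))

  ren-[] : ∀ {n m} (ρ : Fin n → Fin m) (v : Tm (suc n)) t → ren ρ (v [ t ]) ≡ (ren (ext ρ) v) [ ren ρ t ]
  ren-[] ρ v t = trans (ren-sub ρ (sub1 t) v) (trans (sub-cong pointwise v) (sym (sub-ren (sub1 (ren ρ t)) (ext ρ) v)))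
    where
    pointwise : ∀ i → ren ρ (sub1 t i) ≡ sub1 (ren ρ t) (ext ρ i)
    pointwise zero    = refl
    pointwise (suc i) = refl

  sub-[] : ∀ {n m} (θ : Fin n → Tm m) (v : Tm (suc n)) t → sub θ (v [ t ]) ≡ (sub (exts θ) v) [ sub θ t ]
  sub-[] θ v t = trans (sub-sub θ (sub1 t) v) (trans (sub-cong pointwise v) (sym (sub-sub (sub1 (sub θ t)) (exts θ) v)))
    where
    pointwise : ∀ i → sub θ (sub1 t i) ≡ sub (sub1 (sub θ t)) (exts θ i)
    pointwise zero    = refl
    pointwise (suc i) = sym ([]-wk (sub θ t) (θ i))

  cat : ∀ {n} → Tm n → CoTm n → Tm n
  cat (var i)   l = app (var i) l
  cat (lam t)   l = app (lam t) l
  cat (app t k) l = app t (catL k l)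

  catL-abs : ∀ {n} (v : Tm (suc n)) l → catL (abs v) l ≡ abs (cat v (wkL l))
  catL-abs (var i)   l = refl
  catL-abs (lam t)   l = refl
  catL-abs (app t k) l = refl

  renL-catL : ∀ {n k} (ρ : Fin n → Fin k) l m → renL ρ (catL l m) ≡ catL (renL ρ l) (renL ρ m)
  renL-catL ρ (cons u l) m       = cong (cons (ren ρ u)) (renL-catL ρ l m)
  renL-catL ρ (abs (var i)) m    = cong (λ z → abs (app (var (ext ρ i)) z)) (renL-ext-wk ρ m)
  renL-catL ρ (abs (lam t)) m    = cong (λ z → abs (app (lam (ren (ext (ext ρ)) t)) z)) (renL-ext-wk ρ m)
  renL-catL ρ (abs (app t l)) m  = cong (λ z → abs (app (ren (ext ρ) t) z))
    (trans (renL-catL (ext ρ) l (wkL m)) (cong (catL (renL (ext ρ) l)) (renL-ext-wk ρ m)))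

  ren-cat : ∀ {n k} (ρ : Fin n → Fin k) v m → ren ρ (cat v m) ≡ cat (ren ρ v) (renL ρ m)
  ren-cat ρ (var i)   m = refl
  ren-cat ρ (lam t)   m = refl
  ren-cat ρ (app t l) m = cong (app (ren ρ t)) (renL-catL ρ l m)

  catL-assoc : ∀ {n} (l k m : CoTm n) → catL (catL l k) m ≡ catL l (catL k m)
  catL-assoc (cons u l) k m      = cong (cons u) (catL-assoc l k m)
  catL-assoc (abs (var i)) k m   = cong (λ z → abs (app (var i) z)) (sym (renL-catL suc k m))
  catL-assoc (abs (lam t)) k m   = cong (λ z → abs (app (lam t) z)) (sym (renL-catL suc k m))
  catL-assoc (abs (app t l)) k m = cong (λ z → abs (app t z))
    (trans (catL-assoc l (wkL k) (wkL m)) (cong (catL l) (sym (renL-catL suc k m))))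

  cat-assoc : ∀ {n} (v : Tm n) (k m : CoTm n) → cat (cat v k) m ≡ cat v (catL k m)
  cat-assoc (var i)   k m = refl
  cat-assoc (lam t)   k m = refl
  cat-assoc (app t l) k m = cong (app t) (catL-assoc l k m)

  infix 4 _⟶*_ _⟶ₗ*_ _⟶⁺_ _⟶ₗ⁺_
  _⟶*_ : ∀ {n} → Tm n → Tm n → Set
  _⟶*_ = Star _⟶_

  _⟶ₗ*_ : ∀ {n} → CoTm n → CoTm n → Set
  _⟶ₗ*_ = Star _⟶ₗ_

  _⟶⁺_ : ∀ {n} → Tm n → Tm n → Set
  _⟶⁺_ = _⟶_ ⁺

  _⟶ₗ⁺_ : ∀ {n} → CoTm n → CoTm n → Set
  _⟶ₗ⁺_ = _⟶ₗ_ ⁺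

  mutual
    ren-⟶ : ∀ {n m} (ρ : Fin n → Fin m) {t t′} → t ⟶ t′ → ren ρ t ⟶ ren ρ t′
    ren-⟶ ρ (β {t} {u} {l}) =
      subst (λ z → app (lam (ren (ext ρ) t)) (cons (ren ρ u) (renL ρ l)) ⟶ app (ren ρ u) (abs (app (ren (ext ρ) t) z)))
            (sym (renL-ext-wk ρ l)) β
    ren-⟶ ρ (σ {t} {v}) = subst (app (ren ρ t) (abs (ren (ext ρ) v)) ⟶_) (sym (ren-[] ρ v t)) σ
    ren-⟶ ρ (π {t} {u} {l} {l′}) =
      subst (λ z → app (app (ren ρ t) (renL ρ l)) (cons (ren ρ u) (renL ρ l′)) ⟶ app (ren ρ t) z)
            (sym (renL-catL ρ l (cons u l′))) π
    ren-⟶ ρ (ξlam s) = ξlam (ren-⟶ (ext ρ) s)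
    ren-⟶ ρ (ξ₁ s)   = ξ₁ (ren-⟶ ρ s)
    ren-⟶ ρ (ξ₂ s)   = ξ₂ (renL-⟶ₗ ρ s)

    renL-⟶ₗ : ∀ {n m} (ρ : Fin n → Fin m) {l l′} → l ⟶ₗ l′ → renL ρ l ⟶ₗ renL ρ l′
    renL-⟶ₗ ρ (η {l})    = subst (λ z → abs (app (var zero) z) ⟶ₗ renL ρ l) (sym (renL-ext-wk ρ l)) η
    renL-⟶ₗ ρ (ξcons₁ s) = ξcons₁ (ren-⟶ ρ s)
    renL-⟶ₗ ρ (ξcons₂ s) = ξcons₂ (renL-⟶ₗ ρ s)
    renL-⟶ₗ ρ (ξabs s)   = ξabs (ren-⟶ (ext ρ) s)

  ren-⟶* : ∀ {n m} (ρ : Fin n → Fin m) {t t′} → t ⟶* t′ → ren ρ t ⟶* ren ρ t′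
  ren-⟶* ρ = gmap (ren ρ) (ren-⟶ ρ)

  ≡⇒⟶* : ∀ {n} {t t′ : Tm n} → t ≡ t′ → t ⟶* t′
  ≡⇒⟶* refl = ε

  lam* : ∀ {n} {t t′ : Tm (suc n)} → t ⟶* t′ → lam t ⟶* lam t′
  lam* = gmap lam ξlam

  abs* : ∀ {n} {v v′ : Tm (suc n)} → v ⟶* v′ → abs v ⟶ₗ* abs v′
  abs* = gmap abs ξabs

  app* : ∀ {n} {t t′ : Tm n} {l l′} → t ⟶* t′ → l ⟶ₗ* l′ → app t l ⟶* app t′ l′
  app* {t′ = t′} {l = l} ts ls = gmap (λ z → app z l) ξ₁ ts ◅◅ gmap (app t′) ξ₂ ls

  cons* : ∀ {n} {u u′ : Tm n} {l l′} → u ⟶* u′ → l ⟶ₗ* l′ → cons u l ⟶ₗ* cons u′ l′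
  cons* {u′ = u′} {l = l} us ls = gmap (λ z → cons z l) ξcons₁ us ◅◅ gmap (cons u′) ξcons₂ ls

  mutual
    sub-⟶* : ∀ {n m} {θ θ′ : Fin n → Tm m} → (∀ i → θ i ⟶* θ′ i) → ∀ t → sub θ t ⟶* sub θ′ t
    sub-⟶* h (var i)   = h i
    sub-⟶* h (lam t)   = lam* (sub-⟶* (exts-⟶* h) t)
    sub-⟶* h (app t l) = app* (sub-⟶* h t) (subL-⟶ₗ* h l)

    subL-⟶ₗ* : ∀ {n m} {θ θ′ : Fin n → Tm m} → (∀ i → θ i ⟶* θ′ i) → ∀ l → subL θ l ⟶ₗ* subL θ′ l
    subL-⟶ₗ* h (cons u l) = cons* (sub-⟶* h u) (subL-⟶ₗ* h l)
    subL-⟶ₗ* h (abs v)    = abs* (sub-⟶* (exts-⟶* h) v)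

    exts-⟶* : ∀ {n m} {θ θ′ : Fin n → Tm m} → (∀ i → θ i ⟶* θ′ i) → ∀ i → exts θ i ⟶* exts θ′ i
    exts-⟶* h zero    = ε
    exts-⟶* h (suc i) = ren-⟶* suc (h i)

  app⟶*cat : ∀ {n} (t : Tm n) u k → app t (cons u k) ⟶* cat t (cons u k)
  app⟶*cat (var i)   u k = ε
  app⟶*cat (lam t)   u k = ε
  app⟶*cat (app t l) u k = π ◅ ε

  cat⟶cat : ∀ {n} (a : Tm n) m u k → app (cat a m) (cons u k) ⟶ cat (cat a m) (cons u k)
  cat⟶cat (var i)   m u k = π
  cat⟶cat (lam t)   m u k = π
  cat⟶cat (app t l) m u k = π

  mutual
    cat-tail-⟶ : ∀ {n} (v : Tm n) {m m′} → m ⟶ₗ m′ → cat v m ⟶ cat v m′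
    cat-tail-⟶ (var i)   s = ξ₂ s
    cat-tail-⟶ (lam t)   s = ξ₂ s
    cat-tail-⟶ (app t l) s = ξ₂ (catL-tail-⟶ₗ l s)

    catL-tail-⟶ₗ : ∀ {n} (l : CoTm n) {m m′} → m ⟶ₗ m′ → catL l m ⟶ₗ catL l m′
    catL-tail-⟶ₗ (cons u l)      s = ξcons₂ (catL-tail-⟶ₗ l s)
    catL-tail-⟶ₗ (abs (var i))   s = ξabs (ξ₂ (renL-⟶ₗ suc s))
    catL-tail-⟶ₗ (abs (lam t))   s = ξabs (ξ₂ (renL-⟶ₗ suc s))
    catL-tail-⟶ₗ (abs (app t l)) s = ξabs (ξ₂ (catL-tail-⟶ₗ l (renL-⟶ₗ suc s)))

  cat-tail-⟶* : ∀ {n} (v : Tm n) {m m′} → m ⟶ₗ* m′ → cat v m ⟶* cat v m′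
  cat-tail-⟶* v = gmap (cat v) (cat-tail-⟶ v)

  -- λJ^ms: parallel π-contraction

  -- Par c t t′: t′ arises from t by contracting, in parallel, c marked spines
  -- app t (u ∷ k) to cat t (u ∷ k).  A step of t either is matched by
  -- at least one step of t′ or is absorbed by t′ while c decreases.
  mutual
    data Par : {n : ℕ} → ℕ → Tm n → Tm n → Set where
      par-var : ∀ {n} {i : Fin n} → Par 0 (var i) (var i)
      par-lam : ∀ {n c} {t t′ : Tm (suc n)} → Par c t t′ → Par c (lam t) (lam t′)
      par-app : ∀ {n a b} {t t′ : Tm n} {l l′} → Par a t t′ → ParL b l l′ → Par (a + b) (app t l) (app t′ l′)
      par-π   : ∀ {n a b} {t t′ : Tm n} {u k m′ N} → Par a t t′ → ParL b (cons u k) m′ → cat t′ m′ ≡ N →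
                Par (suc (a + b)) (app t (cons u k)) N

    data ParL : {n : ℕ} → ℕ → CoTm n → CoTm n → Set where
      parL-cons : ∀ {n a b} {u u′ : Tm n} {l l′} → Par a u u′ → ParL b l l′ → ParL (a + b) (cons u l) (cons u′ l′)
      parL-abs  : ∀ {n a} {v v′ : Tm (suc n)} → Par a v v′ → ParL a (abs v) (abs v′)

  mutual
    Par-refl : ∀ {n} (t : Tm n) → Par 0 t t
    Par-refl (var i)   = par-var
    Par-refl (lam t)   = par-lam (Par-refl t)
    Par-refl (app t l) = par-app (Par-refl t) (ParL-refl l)

    ParL-refl : ∀ {n} (l : CoTm n) → ParL 0 l l
    ParL-refl (cons u l) = parL-cons (Par-refl u) (ParL-refl l)
    ParL-refl (abs v)    = parL-abs (Par-refl v)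

  ≡⇒Par : ∀ {n} {t t′ : Tm n} → t ≡ t′ → Par 0 t t′
  ≡⇒Par {t = t} refl = Par-refl t

  mutual
    Par⇒⟶* : ∀ {n c} {t t′ : Tm n} → Par c t t′ → t ⟶* t′
    Par⇒⟶* par-var       = ε
    Par⇒⟶* (par-lam p)   = lam* (Par⇒⟶* p)
    Par⇒⟶* (par-app p q) = app* (Par⇒⟶* p) (ParL⇒⟶ₗ* q)
    Par⇒⟶* (par-π {t′ = t′} p q@(parL-cons {u′ = u′} {l′ = k′} _ _) refl) =
      app* (Par⇒⟶* p) (ParL⇒⟶ₗ* q) ◅◅ app⟶*cat t′ u′ k′

    ParL⇒⟶ₗ* : ∀ {n c} {l l′ : CoTm n} → ParL c l l′ → l ⟶ₗ* l′
    ParL⇒⟶ₗ* (parL-cons p q) = cons* (Par⇒⟶* p) (ParL⇒⟶ₗ* q)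
    ParL⇒⟶ₗ* (parL-abs p)    = abs* (Par⇒⟶* p)

  mutual
    ren-Par : ∀ {n m c} (ρ : Fin n → Fin m) {t t′} → Par c t t′ → Par c (ren ρ t) (ren ρ t′)
    ren-Par ρ par-var       = par-var
    ren-Par ρ (par-lam p)   = par-lam (ren-Par (ext ρ) p)
    ren-Par ρ (par-app p q) = par-app (ren-Par ρ p) (renL-Par ρ q)
    ren-Par ρ (par-π {t′ = t′} {m′ = m′} p q refl) = par-π (ren-Par ρ p) (renL-Par ρ q) (sym (ren-cat ρ t′ m′))

    renL-Par : ∀ {n m c} (ρ : Fin n → Fin m) {l l′} → ParL c l l′ → ParL c (renL ρ l) (renL ρ l′)
    renL-Par ρ (parL-cons p q) = parL-cons (ren-Par ρ p) (renL-Par ρ q)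
    renL-Par ρ (parL-abs p)    = parL-abs (ren-Par (ext ρ) p)

  mutual
    Par-ren⁻¹ : ∀ {n m c} (ρ : Fin n → Fin m) (t : Tm n) {N} → Par c (ren ρ t) N →
                ∃ λ t′ → N ≡ ren ρ t′ × Par c t t′
    Par-ren⁻¹ ρ (var i) par-var = var i , refl , par-var
    Par-ren⁻¹ ρ (lam t) (par-lam p) with Par-ren⁻¹ (ext ρ) t p
    ... | t′ , refl , p′ = lam t′ , refl , par-lam p′
    Par-ren⁻¹ ρ (app t l@(cons _ _)) (par-app p q) with Par-ren⁻¹ ρ t p | ParL-ren⁻¹ ρ l q
    ... | t′ , refl , p′ | l′ , refl , q′ = app t′ l′ , refl , par-app p′ q′
    Par-ren⁻¹ ρ (app t l@(abs _)) (par-app p q) with Par-ren⁻¹ ρ t p | ParL-ren⁻¹ ρ l q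
    ... | t′ , refl , p′ | l′ , refl , q′ = app t′ l′ , refl , par-app p′ q′
    Par-ren⁻¹ ρ (app t (cons u k)) (par-π p q e) with Par-ren⁻¹ ρ t p | ParL-ren⁻¹ ρ (cons u k) q
    ... | t′ , refl , p′ | l′ , refl , q′ = cat t′ l′ , trans (sym e) (sym (ren-cat ρ t′ l′)) , par-π p′ q′ refl

    ParL-ren⁻¹ : ∀ {n m c} (ρ : Fin n → Fin m) (l : CoTm n) {N} → ParL c (renL ρ l) N →
                 ∃ λ l′ → N ≡ renL ρ l′ × ParL c l l′
    ParL-ren⁻¹ ρ (cons u l) (parL-cons p q) with Par-ren⁻¹ ρ u p | ParL-ren⁻¹ ρ l q
    ... | u′ , refl , p′ | l′ , refl , q′ = cons u′ l′ , refl , parL-cons p′ q′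
    ParL-ren⁻¹ ρ (abs v) (parL-abs p) with Par-ren⁻¹ (ext ρ) v p
    ... | v′ , refl , p′ = abs v′ , refl , parL-abs p′

  Par-≡ : ∀ {n a b} {t t′ : Tm n} → a ≡ b → Par a t t′ → Par b t t′
  Par-≡ refl p = p

  ParL-≡ : ∀ {n a b} {l l′ : CoTm n} → a ≡ b → ParL a l l′ → ParL b l l′
  ParL-≡ refl p = p

  mutual
    cat-Par : ∀ {n a c} {v v′ : Tm n} {m m′} → Par a v v′ → ParL c m m′ → Par (a + c) (cat v m) (cat v′ m′)
    cat-Par par-var     q = par-app par-var q
    cat-Par (par-lam p) q = par-app (par-lam p) q
    cat-Par {c = c} (par-app {a = a} {b} p p′) q =
      Par-≡ (sym (+-assoc a b c)) (par-app p (catL-Par p′ q))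
    cat-Par {c = c} {m′ = m′} (par-π {a = a} {b} {t′ = t′} {m′ = k′} p p′ refl) q =
      Par-≡ (cong suc (sym (+-assoc a b c))) (par-π p (catL-Par p′ q) (sym (cat-assoc t′ k′ m′)))

    catL-Par : ∀ {n b c} {l l′ : CoTm n} {m m′} → ParL b l l′ → ParL c m m′ → ParL (b + c) (catL l m) (catL l′ m′)
    catL-Par {c = c} (parL-cons {a = a} {b} p p′) q =
      ParL-≡ (sym (+-assoc a b c)) (parL-cons p (catL-Par p′ q))
    catL-Par {m = m} {m′} (parL-abs {v = v} {v′} p) q =
      subst₂ (ParL _) (sym (catL-abs v m)) (sym (catL-abs v′ m′)) (parL-abs (cat-Par p (renL-Par suc q)))

  mutual
    sub-cat-Par : ∀ {n m} (θ : Fin n → Tm m) v u k →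
                  ∃ λ c → Par c (sub θ (cat v (cons u k))) (cat (sub θ v) (subL θ (cons u k)))
    sub-cat-Par θ (var i)   u k = _ , par-π (Par-refl (θ i)) (ParL-refl _) refl
    sub-cat-Par θ (lam t)   u k = _ , Par-refl _
    sub-cat-Par θ (app t l) u k = _ , par-app (Par-refl (sub θ t)) (proj₂ (subL-catL-Par θ l u k))

    subL-catL-Par : ∀ {n m} (θ : Fin n → Tm m) l u k →
                    ∃ λ c → ParL c (subL θ (catL l (cons u k))) (catL (subL θ l) (subL θ (cons u k)))
    subL-catL-Par θ (cons u′ l) u k = _ , parL-cons (Par-refl _) (proj₂ (subL-catL-Par θ l u k))
    subL-catL-Par θ (abs v) u k = _ ,
      subst₂ (ParL _) (cong (subL θ) (sym (catL-abs v (cons u k))))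
        (trans (cong (λ z → abs (cat (sub (exts θ) v) z)) (subL-exts-wk θ (cons u k))) (sym (catL-abs (sub (exts θ) v) _)))
        (parL-abs (proj₂ (sub-cat-Par (exts θ) v (ren suc u) (renL suc k))))

  sub-cat-⟶* : ∀ {n m} (θ : Fin n → Tm m) v u k → sub θ (cat v (cons u k)) ⟶* cat (sub θ v) (subL θ (cons u k))
  sub-cat-⟶* θ v u k = Par⇒⟶* (proj₂ (sub-cat-Par θ v u k))

  mutual
    cat-head-⟶ : ∀ {n} {v v′ : Tm n} u k → v ⟶ v′ → cat v (cons u k) ⟶⁺ cat v′ (cons u k)
    cat-head-⟶ u k (β {t} {u₀} {l₀}) =
      _ , β , ≡⇒⟶* (cong (λ z → app u₀ (abs (app t z))) (renL-catL suc l₀ (cons u k)))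
    cat-head-⟶ u k (σ {t} {w}) =
      _ , subst (λ z → app t z ⟶ (cat w (wkL (cons u k))) [ t ]) (sym (catL-abs w (cons u k))) σ ,
      sub-cat-⟶* (sub1 t) w (ren suc u) (wkL k) ◅◅ ≡⇒⟶* (cong (cat (w [ t ])) ([]-wkL t (cons u k)))
    cat-head-⟶ u k (π {t} {u₀} {l} {l′}) =
      _ , π , ≡⇒⟶* (cong (app t) (sym (catL-assoc l (cons u₀ l′) (cons u k))))
    cat-head-⟶ u k (ξlam s) = _ , ξ₁ (ξlam s) , ε
    cat-head-⟶ u k (ξ₁ s)   = _ , ξ₁ s , ε
    cat-head-⟶ u k (ξ₂ s)   = gmap⁺ (app _) ξ₂ (catL-head-⟶ₗ u k s)

    catL-head-⟶ₗ : ∀ {n} {l l′ : CoTm n} u k → l ⟶ₗ l′ → catL l (cons u k) ⟶ₗ⁺ catL l′ (cons u k)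
    catL-head-⟶ₗ u k (η {l₀}) =
      _ , subst (λ z → abs (app (var zero) z) ⟶ₗ catL l₀ (cons u k)) (renL-catL suc l₀ (cons u k)) η , ε
    catL-head-⟶ₗ u k (ξcons₁ s) = _ , ξcons₁ s , ε
    catL-head-⟶ₗ u k (ξcons₂ s) = gmap⁺ (cons _) ξcons₂ (catL-head-⟶ₗ u k s)
    catL-head-⟶ₗ u k (ξabs {v} {v′} s) =
      subst₂ _⟶ₗ⁺_ (sym (catL-abs v (cons u k))) (sym (catL-abs v′ (cons u k)))
        (gmap⁺ abs ξabs (cat-head-⟶ (ren suc u) (wkL k) s))

  cat-head-⟶* : ∀ {n} {v v′ : Tm n} u k → v ⟶* v′ → cat v (cons u k) ⟶* cat v′ (cons u k)
  cat-head-⟶* u k ε        = ε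
  cat-head-⟶* u k (s ◅ ss) = ⁺⇒⋆ (cat-head-⟶ u k s) ◅◅ cat-head-⟶* u k ss

  cat-head-⟶⁺ : ∀ {n} {v v′ : Tm n} u k → v ⟶⁺ v′ → cat v (cons u k) ⟶⁺ cat v′ (cons u k)
  cat-head-⟶⁺ u k (_ , s , ss) = cat-head-⟶ u k s ⁺◅◅ cat-head-⟶* u k ss

  ParSub : ∀ {n m} → (Fin n → Tm m) → (Fin n → Tm m) → Set
  ParSub θ θ′ = ∀ i → ∃ λ c → Par c (θ i) (θ′ i)

  exts-Par : ∀ {n m} {θ θ′ : Fin n → Tm m} → ParSub θ θ′ → ParSub (exts θ) (exts θ′)
  exts-Par h zero    = 0 , par-var
  exts-Par h (suc i) = proj₁ (h i) , ren-Par suc (proj₂ (h i))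

  sub1-Par : ∀ {n c} {t t′ : Tm n} → Par c t t′ → ParSub (sub1 t) (sub1 t′)
  sub1-Par p zero    = _ , p
  sub1-Par p (suc i) = 0 , par-var

  -- Substitution commutes with Par only up to further reduction of the
  -- contracted side, since substituting into the head of a marked spine may
  -- create new π-redexes.
  mutual
    sub-Par : ∀ {n m c} {v v′ : Tm n} {θ θ′ : Fin n → Tm m} → Par c v v′ → ParSub θ θ′ →
              ∃ λ w → sub θ′ v′ ⟶* w × ∃ λ d → Par d (sub θ v) w
    sub-Par {v = var i} par-var h = _ , ε , h i
    sub-Par (par-lam p) h with sub-Par p (exts-Par h)
    ... | w , r , d , q = lam w , lam* r , d , par-lam q
    sub-Par (par-app p q) h with sub-Par p h | subL-Par q h
    ... | w , r , _ , p′ | l , r′ , _ , q′ = app w l , app* r r′ , _ , par-app p′ q′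
    sub-Par {θ′ = θ′} (par-π {t′ = t′} p q@(parL-cons {u′ = u′} {l′ = k′} _ _) refl) h
      with sub-Par p h | subL-Par q h
    ... | w , r , _ , p′ | l , r′ , _ , q′ =
      cat w l , sub-cat-⟶* θ′ t′ u′ k′ ◅◅ cat-head-⟶* (sub θ′ u′) (subL θ′ k′) r ◅◅ cat-tail-⟶* w r′ ,
      _ , par-π p′ q′ refl

    subL-Par : ∀ {n m c} {l l′ : CoTm n} {θ θ′ : Fin n → Tm m} → ParL c l l′ → ParSub θ θ′ →
               ∃ λ k → subL θ′ l′ ⟶ₗ* k × ∃ λ d → ParL d (subL θ l) k
    subL-Par (parL-cons p q) h with sub-Par p h | subL-Par q h
    ... | w , r , _ , p′ | k , r′ , _ , q′ = cons w k , cons* r r′ , _ , parL-cons p′ q′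
    subL-Par (parL-abs p) h with sub-Par p (exts-Par h)
    ... | w , r , d , q = abs w , abs* r , d , parL-abs q

  Simulated : ∀ {n} → ℕ → Tm n → Tm n → Set
  Simulated c M′ N = (∃ λ N′ → N ⟶⁺ N′ × ∃ λ c′ → Par c′ M′ N′) ⊎ (∃ λ c′ → c′ < c × Par c′ M′ N)

  SimulatedL : ∀ {n} → ℕ → CoTm n → CoTm n → Set
  SimulatedL c M′ N = (∃ λ N′ → N ⟶ₗ⁺ N′ × ∃ λ c′ → ParL c′ M′ N′) ⊎ (∃ λ c′ → c′ < c × ParL c′ M′ N)

  Par-β-redex : ∀ {n c} {t : Tm (suc n)} {u l N} → Par c (app (lam t) (cons u l)) N →
                Simulated c (app u (abs (app t (wkL l)))) N
  Par-β-redex (par-app (par-lam p) (parL-cons q r)) =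
    inj₁ (_ , (_ , β , ε) , _ , par-app q (parL-abs (par-app p (renL-Par suc r))))
  Par-β-redex (par-π (par-lam p) (parL-cons q r) refl) =
    inj₁ (_ , (_ , β , ε) , _ , par-app q (parL-abs (par-app p (renL-Par suc r))))

  Par-σ-redex : ∀ {n c} {t : Tm n} {v N} → Par c (app t (abs v)) N → Simulated c (v [ t ]) N
  Par-σ-redex (par-app p (parL-abs q)) with sub-Par q (sub1-Par p)
  ... | w , r , _ , q′ = inj₁ (w , (_ , σ , r) , _ , q′)

  Par-π-redex : ∀ {n c} {t : Tm n} {l u k N} → Par c (app (app t l) (cons u k)) N →
                Simulated c (app t (catL l (cons u k))) N
  Par-π-redex (par-app (par-app p p′) q@(parL-cons _ _)) = inj₁ (_ , (_ , π , ε) , _ , par-app p (catL-Par p′ q))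
  Par-π-redex (par-app (par-π {t′ = t′} {m′ = m′} p p′ refl) q@(parL-cons {u′ = u′} {l′ = k′} _ _)) =
    inj₁ (_ , (_ , cat⟶cat t′ m′ u′ k′ , ε) , _ , par-π p (catL-Par p′ q) (sym (cat-assoc t′ m′ (cons u′ k′))))
  Par-π-redex (par-π {b = c} (par-app {a = a} {b} p p′) q refl) =
    inj₂ (_ , s≤s (≤-reflexive (sym (+-assoc a b c))) , par-app p (catL-Par p′ q))
  Par-π-redex (par-π {b = c} {m′ = m′} (par-π {a = a} {b} {t′ = t′} {m′ = k′} p p′ refl) q refl) =
    inj₂ (_ , s≤s (s≤s (≤-reflexive (sym (+-assoc a b c)))) , par-π p (catL-Par p′ q) (sym (cat-assoc t′ k′ m′)))

  Par-η⁻¹ : ∀ {n c} {l : CoTm (suc n)} {N} → Par c (app (var zero) l) N →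
            ∃ λ l′ → N ≡ app (var zero) l′ × ∃ λ d → ParL d l l′
  Par-η⁻¹ (par-app par-var q)      = _ , refl , _ , q
  Par-η⁻¹ (par-π par-var q refl) = _ , refl , _ , q

  mutual
    Par-simulation : ∀ {n c} {M N M′ : Tm n} → Par c M N → M ⟶ M′ → Simulated c M′ N
    Par-simulation p β = Par-β-redex p
    Par-simulation p σ = Par-σ-redex p
    Par-simulation p π = Par-π-redex p
    Par-simulation (par-lam p) (ξlam s) with Par-simulation p s
    ... | inj₁ (_ , r , _ , p′) = inj₁ (_ , gmap⁺ lam ξlam r , _ , par-lam p′)
    ... | inj₂ (_ , lt , p′)    = inj₂ (_ , lt , par-lam p′)
    Par-simulation (par-app {b = b} p q) (ξ₁ s) with Par-simulation p s
    ... | inj₁ (_ , r , _ , p′) = inj₁ (_ , gmap⁺ (λ z → app z _) ξ₁ r , _ , par-app p′ q)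
    ... | inj₂ (_ , lt , p′)    = inj₂ (_ , +-monoˡ-< b lt , par-app p′ q)
    Par-simulation (par-app {a = a} p q) (ξ₂ s) with ParL-simulation q s
    ... | inj₁ (_ , r , _ , q′) = inj₁ (_ , gmap⁺ (app _) ξ₂ r , _ , par-app p q′)
    ... | inj₂ (_ , lt , q′)    = inj₂ (_ , +-monoʳ-< a lt , par-app p q′)
    Par-simulation (par-π {b = b} p q@(parL-cons {u′ = u′} {l′ = k′} _ _) refl) (ξ₁ s) with Par-simulation p s
    ... | inj₁ (_ , r , _ , p′) = inj₁ (_ , cat-head-⟶⁺ u′ k′ r , _ , par-π p′ q refl)
    ... | inj₂ (_ , lt , p′)    = inj₂ (_ , s≤s (+-monoˡ-< b lt) , par-π p′ q refl)
    Par-simulation (par-π p q refl) (ξ₂ s@(ξcons₁ _)) = Par-π-tail-simulation p q s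
    Par-simulation (par-π p q refl) (ξ₂ s@(ξcons₂ _)) = Par-π-tail-simulation p q s

    Par-π-tail-simulation : ∀ {n a b} {t t′ : Tm n} {u k m′ u₁ k₁} → Par a t t′ → ParL b (cons u k) m′ →
                            cons u k ⟶ₗ cons u₁ k₁ → Simulated (suc (a + b)) (app t (cons u₁ k₁)) (cat t′ m′)
    Par-π-tail-simulation {a = a} {t′ = t′} p q s with ParL-simulation q s
    ... | inj₁ (_ , r , _ , q′) = inj₁ (_ , gmap⁺ (cat t′) (cat-tail-⟶ t′) r , _ , par-π p q′ refl)
    ... | inj₂ (_ , lt , q′)    = inj₂ (_ , s≤s (+-monoʳ-< a lt) , par-π p q′ refl)

    ParL-simulation : ∀ {n c} {M N M′ : CoTm n} → ParL c M N → M ⟶ₗ M′ → SimulatedL c M′ N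
    ParL-simulation (parL-cons {b = b} p q) (ξcons₁ s) with Par-simulation p s
    ... | inj₁ (_ , r , _ , p′) = inj₁ (_ , gmap⁺ (λ z → cons z _) ξcons₁ r , _ , parL-cons p′ q)
    ... | inj₂ (_ , lt , p′)    = inj₂ (_ , +-monoˡ-< b lt , parL-cons p′ q)
    ParL-simulation (parL-cons {a = a} p q) (ξcons₂ s) with ParL-simulation q s
    ... | inj₁ (_ , r , _ , q′) = inj₁ (_ , gmap⁺ (cons _) ξcons₂ r , _ , parL-cons p q′)
    ... | inj₂ (_ , lt , q′)    = inj₂ (_ , +-monoʳ-< a lt , parL-cons p q′)
    ParL-simulation (parL-abs p) (ξabs s) with Par-simulation p s
    ... | inj₁ (_ , r , _ , p′) = inj₁ (_ , gmap⁺ abs ξabs r , _ , parL-abs p′)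
    ... | inj₂ (_ , lt , p′)    = inj₂ (_ , lt , parL-abs p′)
    ParL-simulation (parL-abs p) (η {l}) with Par-η⁻¹ p
    ... | _ , refl , _ , q with ParL-ren⁻¹ suc l q
    ... | l′ , refl , q′ = inj₁ (l′ , (_ , η , ε) , _ , q′)

  sn-Par : ∀ {n c} {M N : Tm n} → Par c M N → sn _⟶_ N → sn _⟶_ M
  sn-Par p h = expand h ε (<-wellFounded _) p
    where
    mutual
      expand : ∀ {n} {N N′ : Tm n} → sn _⟶_ N → N ⟶* N′ → ∀ {c M} → Acc _<_ c → Par c M N′ → sn _⟶_ M
      expand (acc h) (s ◅ ss) ac p = expand (h s) ss ac p
      expand h ε ac p = acc λ s → expand-simulated h ac (Par-simulation p s)

      expand-simulated : ∀ {n} {N : Tm n} → sn _⟶_ N → ∀ {c M} → Acc _<_ c → Simulated c M N → sn _⟶_ M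
      expand-simulated (acc h) _ (inj₁ (_ , (_ , s , ss) , _ , p)) = expand (h s) ss (<-wellFounded _) p
      expand-simulated h (acc ac) (inj₂ (_ , lt , p))             = expand h ε (ac lt) p

  mutual
    sub-⟶ : ∀ {n m} (θ : Fin n → Tm m) {v v′} → v ⟶ v′ → ∃ λ w → sub θ v ⟶ w × ∃ λ c → Par c (sub θ v′) w
    sub-⟶ θ (β {t} {u} {l}) =
      _ , β , 0 , ≡⇒Par (cong (λ z → app (sub θ u) (abs (app (sub (exts θ) t) z))) (subL-exts-wk θ l))
    sub-⟶ θ (σ {t} {v})        = _ , σ , 0 , ≡⇒Par (sub-[] θ v t)
    sub-⟶ θ (π {t} {u} {l} {k}) = _ , π , _ , par-app (Par-refl _) (proj₂ (subL-catL-Par θ l u k))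
    sub-⟶ θ (ξlam s) with sub-⟶ (exts θ) s
    ... | w , r , _ , p = lam w , ξlam r , _ , par-lam p
    sub-⟶ θ (ξ₁ s) with sub-⟶ θ s
    ... | w , r , _ , p = _ , ξ₁ r , _ , par-app p (ParL-refl _)
    sub-⟶ θ (ξ₂ s) with subL-⟶ₗ θ s
    ... | l , r , _ , q = _ , ξ₂ r , _ , par-app (Par-refl _) q

    subL-⟶ₗ : ∀ {n m} (θ : Fin n → Tm m) {l l′} → l ⟶ₗ l′ → ∃ λ k → subL θ l ⟶ₗ k × ∃ λ c → ParL c (subL θ l′) k
    subL-⟶ₗ θ (η {l}) =
      subL θ l , subst (λ z → abs (app (var zero) z) ⟶ₗ subL θ l) (sym (subL-exts-wk θ l)) η , 0 , ParL-refl _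
    subL-⟶ₗ θ (ξcons₁ s) with sub-⟶ θ s
    ... | w , r , _ , p = _ , ξcons₁ r , _ , parL-cons p (ParL-refl _)
    subL-⟶ₗ θ (ξcons₂ s) with subL-⟶ₗ θ s
    ... | k , r , _ , q = _ , ξcons₂ r , _ , parL-cons (Par-refl _) q
    subL-⟶ₗ θ (ξabs s) with sub-⟶ (exts θ) s
    ... | w , r , _ , p = abs w , ξabs r , _ , parL-abs p

  sn-sub-⟶ : ∀ {n m} (θ : Fin n → Tm m) {v v′} → v ⟶ v′ → sn _⟶_ (sub θ v) → sn _⟶_ (sub θ v′)
  sn-sub-⟶ θ s (acc h) with sub-⟶ θ s
  ... | _ , r , _ , p = sn-Par p (h r)

  sub1-⟶* : ∀ {n} {s s′ : Tm n} → s ⟶ s′ → ∀ i → sub1 s i ⟶* sub1 s′ i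
  sub1-⟶* r zero    = r ◅ ε
  sub1-⟶* r (suc i) = ε

  sn-σ-expansion : ∀ {n} {s : Tm n} {v : Tm (suc n)} → sn _⟶_ s → sn _⟶_ v → sn _⟶_ (v [ s ]) → sn _⟶_ (app s (abs v))
  sn-σ-expansion {s = s} {v} (acc hs) (acc hv) hvs = acc λ where
    σ                → hvs
    (ξ₁ r)           → sn-σ-expansion (hs r) (acc hv) (sn-⋆ hvs (sub-⟶* (sub1-⟶* r) v))
    (ξ₂ (ξabs r))    → sn-σ-expansion (acc hs) (hv r) (sn-sub-⟶ (sub1 s) r hvs)
    (ξ₂ (η {l}))     → subst (λ z → sn _⟶_ (app s z)) ([]-wkL s l) hvs

  sn-β-expansion : ∀ {n} {t : Tm (suc n)} {u : Tm n} {l} → sn _⟶_ (app u (abs (app t (wkL l)))) →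
                   sn _⟶_ (app (lam t) (cons u l))
  sn-β-expansion (acc h) = acc λ where
    β                → acc h
    (ξ₁ (ξlam r))    → sn-β-expansion (h (ξ₂ (ξabs (ξ₁ r))))
    (ξ₂ (ξcons₁ r))  → sn-β-expansion (h (ξ₁ r))
    (ξ₂ (ξcons₂ r))  → sn-β-expansion (h (ξ₂ (ξabs (ξ₂ (renL-⟶ₗ suc r)))))

  sn-var-spine : ∀ {n} {i : Fin n} {u l} → sn _⟶_ u → sn _⟶ₗ_ l → sn _⟶_ (app (var i) (cons u l))
  sn-var-spine (acc hu) (acc hl) = acc λ where
    (ξ₂ (ξcons₁ r))  → sn-var-spine (hu r) (acc hl)
    (ξ₂ (ξcons₂ r))  → sn-var-spine (acc hu) (hl r)

  sn-var : ∀ {n} {i : Fin n} → sn _⟶_ (var i)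
  sn-var = acc λ ()

  sn-π-expansion : ∀ {n} {t : Tm n} {u k} → sn _⟶_ (cat t (cons u k)) → sn _⟶_ (app t (cons u k))
  sn-π-expansion {t = t} = sn-Par (par-π (Par-refl t) (ParL-refl _) refl)

  sn-σπ-expansion : ∀ {n} {t : Tm n} {w u k} → sn _⟶_ t → sn _⟶_ (app w (wkL (cons u k))) →
                    sn _⟶_ (app (w [ t ]) (cons u k)) → sn _⟶_ (app (app t (abs w)) (cons u k))
  sn-σπ-expansion {t = t} {w} {u} {k} ht hw hwt =
    sn-π-expansion (subst (λ z → sn _⟶_ (app t z)) (sym (catL-abs w (cons u k)))
      (sn-σ-expansion ht (sn-⋆ hw (app⟶*cat w _ _)) (sn-Par (proj₂ (sub-cat-Par (sub1 t) w (ren suc u) (wkL k))) hwt-cat)))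
    where
    hwt-cat : sn _⟶_ (cat (w [ t ]) (subL (sub1 t) (wkL (cons u k))))
    hwt-cat = subst (λ z → sn _⟶_ (cat (w [ t ]) z)) (sym ([]-wkL t (cons u k))) (sn-⋆ hwt (app⟶*cat (w [ t ]) u k))

  -- λJ^ms: reducibility

  -- Every clause quantifies over renamings, so that reducibility survives
  -- going under binders.
  mutual
    Red : Ty → ∀ {n} → Tm n → Set
    Red (atom x) {n} t = ∀ {m} (ρ : Fin n → Fin m) → sn _⟶_ (ren ρ t)
    Red (A ⊃ B) {n} t = ∀ {m} (ρ : Fin n → Fin m) u l → Red A u → RedK B l → sn _⟶_ (app (ren ρ t) (cons u l))

    RedK : Ty → ∀ {n} → CoTm n → Set
    RedK B {n} l = ∀ {m} (ρ : Fin n → Fin m) t → Red B t → sn _⟶_ (app t (renL ρ l))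

  RedL : Ty → Ty → ∀ {n} → CoTm n → Set
  RedL A B {n} l = ∀ {m} (ρ : Fin n → Fin m) t → Red A t → Red B (app t (renL ρ l))

  Red-ren : ∀ A {n m} (ρ : Fin n → Fin m) {t} → Red A t → Red A (ren ρ t)
  Red-ren (atom x) ρ {t} h ρ′ = subst (sn _⟶_) (sym (ren-∘ ρ′ ρ t)) (h (ρ′ ∘ ρ))
  Red-ren (A ⊃ B) ρ {t} h ρ′ u l ru rl =
    subst (λ z → sn _⟶_ (app z (cons u l))) (sym (ren-∘ ρ′ ρ t)) (h (ρ′ ∘ ρ) u l ru rl)

  RedK-renL : ∀ B {n m} (ρ : Fin n → Fin m) {l} → RedK B l → RedK B (renL ρ l)
  RedK-renL B ρ {l} h ρ′ t rt = subst (λ z → sn _⟶_ (app t z)) (sym (renL-∘ ρ′ ρ l)) (h (ρ′ ∘ ρ) t rt)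

  RedL-renL : ∀ A B {n m} (ρ : Fin n → Fin m) {l} → RedL A B l → RedL A B (renL ρ l)
  RedL-renL A B ρ {l} h ρ′ t rt = subst (λ z → Red B (app t z)) (sym (renL-∘ ρ′ ρ l)) (h (ρ′ ∘ ρ) t rt)

  Red-apply : ∀ A B {n} {t : Tm n} {u l} → Red (A ⊃ B) t → Red A u → RedK B l → sn _⟶_ (app t (cons u l))
  Red-apply A B {t = t} {u} {l} h ru rl = subst (λ z → sn _⟶_ (app z (cons u l))) (ren-id t) (h id u l ru rl)

  RedK-apply : ∀ B {n} {l : CoTm n} {t} → RedK B l → Red B t → sn _⟶_ (app t l)
  RedK-apply B {l = l} {t} h rt = subst (λ z → sn _⟶_ (app t z)) (renL-id l) (h id t rt)

  RedL-apply : ∀ A B {n} {l : CoTm n} {t} → RedL A B l → Red A t → Red B (app t l)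
  RedL-apply A B {l = l} {t} h rt = subst (λ z → Red B (app t z)) (renL-id l) (h id t rt)

  mutual
    Red⇒sn : ∀ A {n} {t : Tm n} → Red A t → sn _⟶_ t
    Red⇒sn (atom x) {t = t} h = subst (sn _⟶_) (ren-id t) (h id)
    Red⇒sn (A ⊃ B) h =
      sn-reflect₁ (λ t → app (ren suc t) (cons (var zero) (abs (var zero)))) (ξ₁ ∘ ren-⟶ suc)
        (h suc (var zero) (abs (var zero)) (Red-var A) (RedK-abs-var B))

    Red-var : ∀ A {n} {i : Fin n} → Red A (var i)
    Red-var (atom x) ρ              = sn-var
    Red-var (A ⊃ B) ρ u l ru rl     = sn-var-spine (Red⇒sn A ru) (RedK⇒sn B rl)

    RedK⇒sn : ∀ B {n} {l : CoTm n} → RedK B l → sn _⟶ₗ_ l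
    RedK⇒sn B h = sn-reflect₁ (λ l → app (var zero) (wkL l)) (ξ₂ ∘ renL-⟶ₗ suc) (h suc (var zero) (Red-var B))

    RedK-abs-var : ∀ B {n} → RedK B {n} (abs (var zero))
    RedK-abs-var B ρ t rt = sn-σ-expansion (Red⇒sn B rt) sn-var (Red⇒sn B rt)

  RedL⇒RedK : ∀ A B {n} {l : CoTm n} → RedL A B l → RedK A l
  RedL⇒RedK A B h ρ t rt = Red⇒sn B (h ρ t rt)

  RedK-catL : ∀ B C₁ C₂ {n} {l : CoTm n} {u k} → RedL B (C₁ ⊃ C₂) l → Red C₁ u → RedK C₂ k →
              RedK B (catL l (cons u k))
  RedK-catL B C₁ C₂ {l = l} {u} {k} rl ru rk ρ s rs =
    subst (λ z → sn _⟶_ (app s z)) (sym (renL-catL ρ l (cons u k)))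
      (acc-inverse (Red-apply C₁ C₂ (rl ρ s rs) (Red-ren C₁ ρ ru) (RedK-renL C₂ ρ rk)) π)

  Red-spine : ∀ A B C {n} {t u : Tm n} {l} → Red (A ⊃ B) t → Red A u → RedL B C l → Red C (app t (cons u l))
  Red-spine A B (atom x) rt ru rl ρ =
    rt ρ _ _ (Red-ren A ρ ru) (RedK-renL B ρ (RedL⇒RedK B (atom x) rl))
  Red-spine A B (C₁ ⊃ C₂) rt ru rl ρ u₂ k₂ ru₂ rk₂ =
    sn-π-expansion (rt ρ _ _ (Red-ren A ρ ru) (RedK-catL B C₁ C₂ (RedL-renL B (C₁ ⊃ C₂) ρ rl) ru₂ rk₂))

  Red-σ-expansion : ∀ A B {n} {t : Tm n} {w} → Red A t → Red B w → Red B (w [ t ]) → Red B (app t (abs w))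
  Red-σ-expansion A (atom x) {t = t} {w} rt rw rwt ρ =
    sn-σ-expansion (Red⇒sn A (Red-ren A ρ rt)) (rw (ext ρ)) (subst (sn _⟶_) (ren-[] ρ w t) (rwt ρ))
  Red-σ-expansion A (C₁ ⊃ C₂) {t = t} {w} rt rw rwt ρ u k ru rk =
    sn-σπ-expansion (Red⇒sn A (Red-ren A ρ rt))
      (Red-apply C₁ C₂ (Red-ren (C₁ ⊃ C₂) (ext ρ) rw) (Red-ren C₁ suc ru) (RedK-renL C₂ suc rk))
      (Red-apply C₁ C₂ (subst (Red (C₁ ⊃ C₂)) (ren-[] ρ w t) (Red-ren (C₁ ⊃ C₂) ρ rwt)) ru rk)

  Red-lam : ∀ A B {n} {t : Tm (suc n)} →
            (∀ {m} (ρ : Fin n → Fin m) → Red B (ren (ext ρ) t)) →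
            (∀ {m} (ρ : Fin n → Fin m) {s} → Red A s → Red B ((ren (ext ρ) t) [ s ])) →
            Red (A ⊃ B) (lam t)
  Red-lam A B {t = t} rt rts ρ u l ru rl =
    sn-β-expansion (sn-σ-expansion (Red⇒sn A ru) (rl suc _ (rt ρ))
      (subst (λ z → sn _⟶_ (app ((ren (ext ρ) t) [ u ]) z)) (sym ([]-wkL u l)) (RedK-apply B rl (rts ρ ru))))

  RedSub : ∀ {n m} → Vec Ty n → (Fin n → Tm m) → Set
  RedSub Γ θ = ∀ i → Red (lookup Γ i) (θ i)

  RedSub-ren : ∀ {n m k} (Γ : Vec Ty n) {θ : Fin n → Tm m} (ρ : Fin m → Fin k) → RedSub Γ θ → RedSub Γ (ren ρ ∘ θ)
  RedSub-ren Γ ρ h i = Red-ren (lookup Γ i) ρ (h i)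

  RedSub-exts : ∀ {n m} {Γ : Vec Ty n} {A} {θ : Fin n → Tm m} → RedSub Γ θ → RedSub (A ∷ Γ) (exts θ)
  RedSub-exts {A = A} h zero    = Red-var A
  RedSub-exts {Γ = Γ} h (suc i) = Red-ren (lookup Γ i) suc (h i)

  RedSub-∷ : ∀ {n m} {Γ : Vec Ty n} {A} {θ : Fin n → Tm m} {s} → Red A s → RedSub Γ θ → RedSub (A ∷ Γ) (s ∷ₛ θ)
  RedSub-∷ rs h zero    = rs
  RedSub-∷ rs h (suc i) = h i

  mutual
    Red-sub : ∀ {n} {Γ : Vec Ty n} {t A} → Γ ⊢ t ∶ A → ∀ {m} {θ : Fin n → Tm m} → RedSub Γ θ → Red A (sub θ t)
    Red-sub (ax i) h = h i
    Red-sub {Γ = Γ} (⊃I {A} {B} {t} d) {θ = θ} h = Red-lam A B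
      (λ ρ → subst (Red B) (sym (ren-exts-sub ρ θ t)) (Red-sub d (RedSub-exts (RedSub-ren Γ ρ h))))
      (λ ρ {s} rs → subst (Red B) (sym (trans (cong (_[ s ]) (ren-exts-sub ρ θ t)) ([]-exts s (ren ρ ∘ θ) t)))
                      (Red-sub d (RedSub-∷ rs (RedSub-ren Γ ρ h))))
    Red-sub (cut {A} {B} d e) h = RedL-apply A B (RedL-subL e h) (Red-sub d h)

    RedL-subL : ∀ {n} {Γ : Vec Ty n} {l A B} → Γ ∣ l ∶ A ⊢ B → ∀ {m} {θ : Fin n → Tm m} → RedSub Γ θ →
                RedL A B (subL θ l)
    RedL-subL (⊃L {A} {B} {C} d e) h ρ s rs =
      Red-spine A B C rs (Red-ren A ρ (Red-sub d h)) (RedL-renL B C ρ (RedL-subL e h))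
    RedL-subL {Γ = Γ} (sel {A} {B} {v} d) {θ = θ} h ρ s rs =
      subst (λ z → Red B (app s (abs z))) (sym (ren-exts-sub ρ θ v))
        (Red-σ-expansion A B rs (Red-sub d (RedSub-exts (RedSub-ren Γ ρ h)))
          (subst (Red B) (sym ([]-exts s (ren ρ ∘ θ) v)) (Red-sub d (RedSub-∷ rs (RedSub-ren Γ ρ h)))))

  typable⇒sn : ∀ {n} {t : Tm n} → Typable t → sn _⟶_ t
  typable⇒sn {t = t} (Γ , A , d) =
    Red⇒sn A (subst (Red A) (sub-var t) (Red-sub d (λ i → Red-var (lookup Γ i))))

-- λJ^m embeds into λJ^ms

module MsOfM where

  module S = Jms
  module M = Jm
  open S using (var; lam; app; cons; abs; β; σ; π; ξlam; ξ₁; ξ₂; η; ξcons₁; ξcons₂; ξabs)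
  open Ms hiding (typable⇒sn)

  mutual
    toMs : ∀ {n} → M.Tm n → S.Tm n
    toMs (M.var i)     = var i
    toMs (M.lam t)     = lam (toMs t)
    toMs (M.app t u l) = app (toMs t) (cons (toMs u) (toMsL l))

    toMsL : ∀ {n} → M.CoTm n → S.CoTm n
    toMsL (M.cons u l) = cons (toMs u) (toMsL l)
    toMsL (M.abs v)    = abs (toMs v)

  mutual
    toMs-ren : ∀ {n m} (ρ : Fin n → Fin m) t → toMs (M.ren ρ t) ≡ S.ren ρ (toMs t)
    toMs-ren ρ (M.var i)     = refl
    toMs-ren ρ (M.lam t)     = cong lam (toMs-ren (ext ρ) t)
    toMs-ren ρ (M.app t u l) = cong₂ app (toMs-ren ρ t) (cong₂ cons (toMs-ren ρ u) (toMsL-renL ρ l))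

    toMsL-renL : ∀ {n m} (ρ : Fin n → Fin m) l → toMsL (M.renL ρ l) ≡ S.renL ρ (toMsL l)
    toMsL-renL ρ (M.cons u l) = cong₂ cons (toMs-ren ρ u) (toMsL-renL ρ l)
    toMsL-renL ρ (M.abs v)    = cong abs (toMs-ren (ext ρ) v)

  toMs-exts : ∀ {n m} (θ : Fin n → M.Tm m) i → toMs (M.exts θ i) ≡ S.exts (toMs ∘ θ) i
  toMs-exts θ zero    = refl
  toMs-exts θ (suc i) = toMs-ren suc (θ i)

  mutual
    toMs-sub : ∀ {n m} (θ : Fin n → M.Tm m) t → toMs (M.sub θ t) ≡ S.sub (toMs ∘ θ) (toMs t)
    toMs-sub θ (M.var i)     = refl
    toMs-sub θ (M.lam t)     = cong lam (trans (toMs-sub (M.exts θ) t) (sub-cong (toMs-exts θ) (toMs t)))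
    toMs-sub θ (M.app t u l) = cong₂ app (toMs-sub θ t) (cong₂ cons (toMs-sub θ u) (toMsL-subL θ l))

    toMsL-subL : ∀ {n m} (θ : Fin n → M.Tm m) l → toMsL (M.subL θ l) ≡ S.subL (toMs ∘ θ) (toMsL l)
    toMsL-subL θ (M.cons u l) = cong₂ cons (toMs-sub θ u) (toMsL-subL θ l)
    toMsL-subL θ (M.abs v)    = cong abs (trans (toMs-sub (M.exts θ) v) (sub-cong (toMs-exts θ) (toMs v)))

  toMs-[] : ∀ {n} (t : M.Tm (suc n)) u → toMs (t M.[ u ]) ≡ (toMs t) S.[ toMs u ]
  toMs-[] t u = trans (toMs-sub (M.sub1 u) t) (sub-cong pointwise (toMs t))
    where
    pointwise : ∀ i → toMs (M.sub1 u i) ≡ S.sub1 (toMs u) i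
    pointwise zero    = refl
    pointwise (suc i) = refl

  toMsL-catL : ∀ {n} (l : M.CoTm n) u k → toMsL (M.catL l u k) ≡ S.catL (toMsL l) (cons (toMs u) (toMsL k))
  toMsL-catL (M.cons u′ l) u k = cong (cons (toMs u′)) (toMsL-catL l u k)
  toMsL-catL (M.abs (M.var i)) u k =
    cong (λ z → abs (app (var i) z)) (cong₂ cons (toMs-ren suc u) (toMsL-renL suc k))
  toMsL-catL (M.abs (M.lam t)) u k =
    cong (λ z → abs (app (lam (toMs t)) z)) (cong₂ cons (toMs-ren suc u) (toMsL-renL suc k))
  toMsL-catL (M.abs (M.app t u′ l)) u k = cong (λ z → abs (app (toMs t) (cons (toMs u′) z)))
    (trans (toMsL-catL l (M.ren suc u) (M.renL suc k))
           (cong (S.catL (toMsL l)) (cong₂ cons (toMs-ren suc u) (toMsL-renL suc k))))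

  -- Both β-rules of λJ^m become a β-step followed by a σ-step; β₁ needs one
  -- further σ-step for the selection (y)v.
  mutual
    toMs-⟶ : ∀ {n} {t t′ : M.Tm n} → t M.⟶ t′ → toMs t ⟶⁺ toMs t′
    toMs-⟶ (M.β₁ {t} {u} {v}) =
      _ , β , σ ◅ ≡⇒⟶* (cong (λ z → app (toMs t S.[ toMs u ]) (abs z)) (sub-ren-cancel exts-sub1-ext-suc (toMs v)))
            ◅◅ σ ◅ ≡⇒⟶* (sym (trans (toMs-[] v (t M.[ u ])) (cong (toMs v S.[_]) (toMs-[] t u))))
      where
      exts-sub1-ext-suc : ∀ i → S.exts (S.sub1 (toMs u)) (ext suc i) ≡ var i
      exts-sub1-ext-suc zero    = refl
      exts-sub1-ext-suc (suc i) = refl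
    toMs-⟶ (M.β₂ {t} {u} {v} {l}) =
      _ , β , σ ◅ ≡⇒⟶* (cong₂ app (sym (toMs-[] t u)) ([]-wkL (toMs u) (cons (toMs v) (toMsL l))))
    toMs-⟶ (M.π {t} {u} {u′} {l} {l′}) =
      _ , π , ≡⇒⟶* (cong (λ z → app (toMs t) (cons (toMs u) z)) (sym (toMsL-catL l u′ l′)))
    toMs-⟶ (M.ξlam s) = gmap⁺ lam ξlam (toMs-⟶ s)
    toMs-⟶ (M.ξ₁ s)   = gmap⁺ (λ z → app z _) ξ₁ (toMs-⟶ s)
    toMs-⟶ (M.ξ₂ s)   = gmap⁺ (λ z → app _ (cons z _)) (ξ₂ ∘ ξcons₁) (toMs-⟶ s)
    toMs-⟶ (M.ξ₃ s)   = gmap⁺ (λ z → app _ (cons _ z)) (ξ₂ ∘ ξcons₂) (toMsL-⟶ₗ s)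

    toMsL-⟶ₗ : ∀ {n} {l l′ : M.CoTm n} → l M.⟶ₗ l′ → toMsL l ⟶ₗ⁺ toMsL l′
    toMsL-⟶ₗ (M.η {u} {l}) =
      _ , subst (λ z → abs (app (var zero) z) S.⟶ₗ cons (toMs u) (toMsL l))
                (sym (cong₂ cons (toMs-ren suc u) (toMsL-renL suc l))) η , ε
    toMsL-⟶ₗ (M.ξcons₁ s) = gmap⁺ (λ z → cons z _) ξcons₁ (toMs-⟶ s)
    toMsL-⟶ₗ (M.ξcons₂ s) = gmap⁺ (cons _) ξcons₂ (toMsL-⟶ₗ s)
    toMsL-⟶ₗ (M.ξabs s)   = gmap⁺ abs ξabs (toMs-⟶ s)

  mutual
    toMs-⊢ : ∀ {n} {Γ : Vec Ty n} {t A} → Γ M.⊢ t ∶ A → Γ S.⊢ toMs t ∶ A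
    toMs-⊢ (M.ax i)       = S.ax i
    toMs-⊢ (M.⊃I d)       = S.⊃I (toMs-⊢ d)
    toMs-⊢ (M.⊃E d d′ e)  = S.cut (toMs-⊢ d) (S.⊃L (toMs-⊢ d′) (toMsL-⊢ e))

    toMsL-⊢ : ∀ {n} {Γ : Vec Ty n} {l A B} → Γ M.∣ l ∶ A ⊢ B → Γ S.∣ toMsL l ∶ A ⊢ B
    toMsL-⊢ (M.⊃L d e) = S.⊃L (toMs-⊢ d) (toMsL-⊢ e)
    toMsL-⊢ (M.sel d)  = S.sel (toMs-⊢ d)

  typable⇒sn : ∀ {n} {t : M.Tm n} → M.Typable t → sn M._⟶_ t
  typable⇒sn (Γ , A , d) = sn-reflect toMs toMs-⟶ (Ms.typable⇒sn (Γ , A , toMs-⊢ d))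

-- λJ embeds into λJ^m

module MOfJ where

  module M = Jm

  cong₃ : ∀ {A B C D : Set} (f : A → B → C → D) {a a′ b b′ c c′} → a ≡ a′ → b ≡ b′ → c ≡ c′ → f a b c ≡ f a′ b′ c′
  cong₃ f refl refl refl = refl

  exts-cong : ∀ {n m} {θ θ′ : Fin n → M.Tm m} → (∀ i → θ i ≡ θ′ i) → ∀ i → M.exts θ i ≡ M.exts θ′ i
  exts-cong h zero    = refl
  exts-cong h (suc i) = cong (M.ren suc) (h i)

  mutual
    sub-cong : ∀ {n m} {θ θ′ : Fin n → M.Tm m} → (∀ i → θ i ≡ θ′ i) → ∀ t → M.sub θ t ≡ M.sub θ′ t
    sub-cong h (M.var i)     = h i
    sub-cong h (M.lam t)     = cong M.lam (sub-cong (exts-cong h) t)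
    sub-cong h (M.app t u l) = cong₃ M.app (sub-cong h t) (sub-cong h u) (subL-cong h l)

    subL-cong : ∀ {n m} {θ θ′ : Fin n → M.Tm m} → (∀ i → θ i ≡ θ′ i) → ∀ l → M.subL θ l ≡ M.subL θ′ l
    subL-cong h (M.cons u l) = cong₂ M.cons (sub-cong h u) (subL-cong h l)
    subL-cong h (M.abs v)    = cong M.abs (sub-cong (exts-cong h) v)

  toM : ∀ {n} → J.Tm n → M.Tm n
  toM (J.var i)     = M.var i
  toM (J.lam t)     = M.lam (toM t)
  toM (J.app t u v) = M.app (toM t) (toM u) (M.abs (toM v))

  toM-ren : ∀ {n m} (ρ : Fin n → Fin m) t → toM (J.ren ρ t) ≡ M.ren ρ (toM t)
  toM-ren ρ (J.var i)     = refl
  toM-ren ρ (J.lam t)     = cong M.lam (toM-ren (ext ρ) t)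
  toM-ren ρ (J.app t u v) = cong₃ (λ a b c → M.app a b (M.abs c)) (toM-ren ρ t) (toM-ren ρ u) (toM-ren (ext ρ) v)

  toM-exts : ∀ {n m} (θ : Fin n → J.Tm m) i → toM (J.exts θ i) ≡ M.exts (toM ∘ θ) i
  toM-exts θ zero    = refl
  toM-exts θ (suc i) = toM-ren suc (θ i)

  toM-sub : ∀ {n m} (θ : Fin n → J.Tm m) t → toM (J.sub θ t) ≡ M.sub (toM ∘ θ) (toM t)
  toM-sub θ (J.var i)     = refl
  toM-sub θ (J.lam t)     = cong M.lam (trans (toM-sub (J.exts θ) t) (sub-cong (toM-exts θ) (toM t)))
  toM-sub θ (J.app t u v) = cong₃ (λ a b c → M.app a b (M.abs c)) (toM-sub θ t) (toM-sub θ u)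
    (trans (toM-sub (J.exts θ) v) (sub-cong (toM-exts θ) (toM v)))

  toM-[] : ∀ {n} (t : J.Tm (suc n)) u → toM (t J.[ u ]) ≡ (toM t) M.[ toM u ]
  toM-[] t u = trans (toM-sub (J.sub1 u) t) (sub-cong pointwise (toM t))
    where
    pointwise : ∀ i → toM (J.sub1 u i) ≡ M.sub1 (toM u) i
    pointwise zero    = refl
    pointwise (suc i) = refl

  toM-cat : ∀ {n} (v : J.Tm (suc n)) u′ v′ →
            M.catL (M.abs (toM v)) (toM u′) (M.abs (toM v′)) ≡ M.abs (toM (J.cat v (J.wk u′) (J.wk1 v′)))
  toM-cat (J.var i) u′ v′ =
    cong₂ (λ a b → M.abs (M.app (M.var i) a (M.abs b))) (sym (toM-ren suc u′)) (sym (toM-ren (ext suc) v′))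
  toM-cat (J.lam t) u′ v′ =
    cong₂ (λ a b → M.abs (M.app (M.lam (toM t)) a (M.abs b))) (sym (toM-ren suc u′)) (sym (toM-ren (ext suc) v′))
  toM-cat (J.app t u w) u′ v′ = cong (λ z → M.abs (M.app (toM t) (toM u) z))
    (trans (cong₂ (λ a b → M.catL (M.abs (toM w)) a (M.abs b)) (sym (toM-ren suc u′)) (sym (toM-ren (ext suc) v′)))
           (toM-cat w (J.wk u′) (J.wk1 v′)))

  toM-⟶ : ∀ {n} {t t′ : J.Tm n} → t J.⟶ t′ → toM t M.⟶ toM t′
  toM-⟶ (J.β {t} {u} {v}) =
    subst (toM (J.app (J.lam t) u v) M.⟶_) (sym (trans (toM-[] v (t J.[ u ])) (cong (toM v M.[_]) (toM-[] t u)))) M.β₁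
  toM-⟶ (J.π {t} {u} {u′} {v} {v′}) =
    subst (λ z → toM (J.app (J.app t u v) u′ v′) M.⟶ M.app (toM t) (toM u) z) (toM-cat v u′ v′) M.π
  toM-⟶ (J.ξlam s) = M.ξlam (toM-⟶ s)
  toM-⟶ (J.ξ₁ s)   = M.ξ₁ (toM-⟶ s)
  toM-⟶ (J.ξ₂ s)   = M.ξ₂ (toM-⟶ s)
  toM-⟶ (J.ξ₃ s)   = M.ξ₃ (M.ξabs (toM-⟶ s))

  toM-⊢ : ∀ {n} {Γ : Vec Ty n} {t A} → Γ J.⊢ t ∶ A → Γ M.⊢ toM t ∶ A
  toM-⊢ (J.ax i)       = M.ax i
  toM-⊢ (J.⊃I d)       = M.⊃I (toM-⊢ d)
  toM-⊢ (J.⊃E d d′ e)  = M.⊃E (toM-⊢ d) (toM-⊢ d′) (M.sel (toM-⊢ e))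

  typable⇒sn : ∀ {n} {t : J.Tm n} → J.Typable t → sn J._⟶_ t
  typable⇒sn (Γ , A , d) = sn-reflect₁ toM toM-⟶ (MsOfM.typable⇒sn (Γ , A , toM-⊢ d))

corollary4p6 : ((n : ℕ) (t : Jms.Tm n) → Jms.Typable t → SN Jms._⟶_ t)
             × ((n : ℕ) (t : Jm.Tm n) → Jm.Typable t → SN Jm._⟶_ t)
             × ((n : ℕ) (t : J.Tm n) → J.Typable t → SN J._⟶_ t)
corollary4p6 = (λ _ _ → sn⇒SN ∘ Ms.typable⇒sn)
             , (λ _ _ → sn⇒SN ∘ MsOfM.typable⇒sn)
             , (λ _ _ → sn⇒SN ∘ MOfJ.typable⇒sn)
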